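{- For $m\in\mathbb{N}$ let \[ x_m=(-1)^{m-1}\sum_{\ell=0}^{m}(-1)^{\ell-1}S(m,\ell)(2\ell-3)!!, \] so that $(x_1,x_2,x_3,x_4,x_5,x_6,\dots)=(1,0,1,3,16,105,\dots)$. For integers $n\ge k\ge0$ let $P(n,k)=k!\,[2(n-k)-1]!!\binom{2n-k-1}{2(n-k)}$. Then for all integers $n\ge k\ge 0$, \[ B_{n,k}(x_1,x_2,\dots,x_{n-k+1})=\frac{(-1)^n}{k!}\sum_{\ell=k}^{n}(-1)^{\ell}S(n,\ell)P(\ell,k). \]
   Context: $S(n,\ell)$ are the Stirling numbers of the second kind, given by $\frac{(e^x-1)^\ell}{\ell!}=\sum_{n\ge \ell}S(n,\ell)\frac{x^n}{n!}$. The Bell polynomials of the second kind are \[ B_{n,k}(x_1,\dots,x_{n-k+1})=\sum\frac{n!}{\prod_{i}\ell_i!}\prod_{i=1}^{n-k+1}\Big(\frac{x_i}{i!}\Big)^{\ell_i}, \] where the sum is over nonnegative integers $\ell_1,\dots,\ell_{n-k+1}$ with $\sum i\ell_i=n$ and $\sum\ell_i=k$. Double factorials: $(2j-1)!!=1\cdot3\cdots(2j-1)$ for $j\ge1$, and $[-(2j+1)]!!=(-1)^j/(2j-1)!!$ for $j\ge0$, so $(-1)!!=1$ and $(-3)!!=-1$. The binomial $\binom{2n-k-1}{2(n-k)}$ equals $1$ when $n=k$. -}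

module Defs where

open import Data.Nat.Base as ℕ using (ℕ; zero; suc; _∸_; _!; NonZero)
open import Data.Nat.Properties using (_≟_; _!≢0; m*n≢0)
open import Data.Nat.Combinatorics using (_C_)
open import Data.Integer.Base as ℤ using (ℤ; +_; -[1+_]; 1ℤ)
open import Data.Fin.Base using (toℕ)
open import Data.List.Base as List using (List; []; _∷_)
open import Data.Vec.Base as Vec using (Vec; []; _∷_)
open import Data.Vec.Functional using (Vector)
open import Data.Rational.Base using (ℚ; 0ℚ; 1ℚ; _+_; _*_; _-_; -_; _/_; +-*-rawSemiring)
open import Relation.Nullary.Decidable using (_×-dec_)
open import Algebra.Definitions.RawSemiring +-*-rawSemiring public
  using (_^_; sum; product)

fromℕ : ℕ → ℚ
fromℕ n = + n / 1

1/fact : ℕ → ℚ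
1/fact n = (+ 1 / (n !)) {{n !≢0}}

-- ∑[ i ∈ a ⋯ b ] f i ranges over a ≤ i ≤ b and is empty when b < a.
∑ : ℕ → ℕ → (ℕ → ℚ) → ℚ
∑ a b f = sum {suc b ∸ a} (λ i → f (a ℕ.+ toℕ i))

syntax ∑ a b (λ i → e) = ∑[ i ∈ a ⋯ b ] e
infix 5 ∑

-- (-1)^z; negative exponents are harmless because (-1)⁻¹ = -1.
[-1]^_ : ℤ → ℚ
[-1]^ z = (- 1ℚ) ^ ℤ.∣ z ∣
infix 9 [-1]^_

-- Formal power series over ℚ: f n is the coefficient of xⁿ.
Series : Set
Series = ℕ → ℚ

1ₛ : Series
1ₛ zero    = 1ℚ
1ₛ (suc _) = 0ℚ

_-ₛ_ _*ₛ_ : Series → Series → Series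
(f -ₛ g) n = f n - g n
(f *ₛ g) n = ∑[ i ∈ 0 ⋯ n ] f i * g (n ∸ i)

_^ₛ_ : Series → ℕ → Series
f ^ₛ zero  = 1ₛ
f ^ₛ suc ℓ = f *ₛ (f ^ₛ ℓ)

expₛ : Series
expₛ = 1/fact

-- n! times the coefficient of xⁿ in (eˣ - 1)^ℓ / ℓ!.
S : ℕ → ℕ → ℚ
S n ℓ = fromℕ (n !) * (1/fact ℓ * ((expₛ -ₛ 1ₛ) ^ₛ ℓ) n)

-- odd!! j = 1 · 3 ⋯ (2j - 1)
odd!! : ℕ → ℕ
odd!! zero    = 1
odd!! (suc j) = suc (2 ℕ.* j) ℕ.* odd!! j

odd!!≢0 : ∀ j → NonZero (odd!! j)
odd!!≢0 zero    = _
odd!!≢0 (suc j) = m*n≢0 (suc (2 ℕ.* j)) (odd!! j) {{_}} {{odd!!≢0 j}}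

-- [2 z -1]!! is the double factorial of the odd integer 2z - 1.  The second
-- clause is [-(2i+1)]!! = (-1)ⁱ / (2i-1)!! with i = suc j, since
-- 2(-i) - 1 = -(2i + 1).
[2_-1]!! : ℤ → ℚ
[2 + j      -1]!! = fromℕ (odd!! j)
[2 -[1+ j ] -1]!! = [-1]^ (+ suc j) * (+ 1 / odd!! (suc j)) {{odd!!≢0 (suc j)}}

tuples : ℕ → (N : ℕ) → List (Vec ℕ N)
tuples b zero    = [] ∷ []
tuples b (suc N) = List.cartesianProductWith _∷_ (List.upTo (suc b)) (tuples b N)

-- Vectors are indexed from 0, so the position i : Fin N carries ℓ_{i+1}.
weight : ∀ {N} → Vec ℕ N → ℕ
weight ℓ = Vec.sum (Vec.tabulate (λ i → suc (toℕ i) ℕ.* Vec.lookup ℓ i))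

-- All (ℓ₁, …, ℓ_N) with ∑ i ℓᵢ = n and ∑ ℓᵢ = k; the latter forces every
-- ℓᵢ ≤ k, so nothing is lost by searching among tuples bounded by k.
exponents : (n k N : ℕ) → List (Vec ℕ N)
exponents n k N =
  List.filter (λ ℓ → (weight ℓ ≟ n) ×-dec (Vec.sum ℓ ≟ k)) (tuples k N)

-- Meaningful for k ≤ n; the argument is (x₁, …, x_{n-k+1}), with x_{i+1} at
-- position i.
B : (n k : ℕ) → Vector ℚ (suc (n ∸ k)) → ℚ
B n k x = List.foldr _+_ 0ℚ (List.map term (exponents n k (suc (n ∸ k))))
  where
  term : Vec ℕ (suc (n ∸ k)) → ℚ
  term ℓ = fromℕ (n !)
         * product (λ i → 1/fact (Vec.lookup ℓ i))
         * product (λ i → (x i * 1/fact (suc (toℕ i))) ^ Vec.lookup ℓ i)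

x : ℕ → ℚ
x m = [-1]^ (+ m ℤ.- 1ℤ)
    * (∑[ ℓ ∈ 0 ⋯ m ] [-1]^ (+ ℓ ℤ.- 1ℤ) * S m ℓ * [2 + ℓ ℤ.- 1ℤ -1]!!)

-- Meaningful for k ≤ n.  Truncated subtraction only matters at n = k = 0, where
-- the upper entry 2n - k - 1 = -1 becomes 0 and the binomial is 1, matching the
-- convention that it equals 1 whenever n = k.
P : ℕ → ℕ → ℚ
P n k = fromℕ (k !) * [2 + (n ∸ k) -1]!!
      * fromℕ ((2 ℕ.* n ∸ k ∸ 1) C (2 ℕ.* (n ∸ k)))

{-# OPTIONS --safe #-}

-- Put γ(w) = ∑ (-1)ᵈ⁺¹ (2d-1)!! wᵈ / (d+1)!, so that 1 - √(1 + 2w) = w γ(w).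
-- Then ∑_{m≥1} xₘ tᵐ / m! = 1 - √(2e⁻ᵗ - 1) is w γ(w) at w = e⁻ᵗ - 1, while
-- B_{n,k}(x₁, x₂, …) is n! / k! times the coefficient of tⁿ in its k-th power.
-- Since (w γ)ᵏ = ∑_ℓ (-1)ˡ P(ℓ,k) wˡ / ℓ! and (eᵗ - 1)ˡ generates the Stirling
-- numbers S(·,ℓ), composing the two series gives the formula.  The closed form
-- of γᵏ follows from γ² = 2 (γ - γ(0)) / w, which determines γᵏ⁺² from γᵏ⁺¹ and γᵏ.
module Submission where

open import Defs
open import Algebra.Bundles using (CommutativeRing)
open import Data.Fin.Base using (Fin; toℕ) renaming (zero to fzero; suc to fsuc)
import Data.Fin.Properties as Fin
import Data.Integer.Base as ℤ
import Data.Integer.Properties as ℤ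
open import Data.List.Base as List using (List; []; _∷_; map)
import Data.List.Properties as List
open import Data.Nat.Base as ℕ using (ℕ; zero; suc; _≤_; _<_; z≤n; s≤s; s≤s⁻¹; _∸_; _!)
open import Data.Nat.Combinatorics using (_C_; nCk+nC[k+1]≡[n+1]C[k+1]; nC1≡n; nCn≡1; k>n⇒nCk≡0)
import Data.Nat.Properties as ℕ
open import Data.Nat.Solver using () renaming (module +-*-Solver to ℕ-Solver)
open ℕ-Solver using () renaming
  (solve to solve-ℕ; _:+_ to _⊕_; _:*_ to _⊗_; _:=_ to _⊜_; con to con-ℕ)
open import Data.Product.Base using (_×_; _,_)
open import Data.Rational.Base using (ℚ; 0ℚ; 1ℚ; _+_; _*_; -_; _/_; fromℚᵘ)
import Data.Rational.Properties as ℚ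
open import Data.Rational.Solver using (module +-*-Solver)
open +-*-Solver using (solve; _:=_; _:+_; _:*_; :-_; con)
open import Data.Rational.Unnormalised.Base as ℚᵘ using (mkℚᵘ; *≡*)
import Data.Rational.Unnormalised.Properties as ℚᵘ
open import Data.Vec.Base as Vec using (Vec; []; _∷_)
open import Data.Vec.Functional using (Vector)
import Data.Vec.Properties as Vec
open import Algebra.Properties.CommutativeSemigroup ℕ.+-commutativeSemigroup using (interchange)
open import Algebra.Properties.Semiring.Sum (CommutativeRing.semiring ℚ.+-*-commutativeRing)
  using (sum-cong-≗; ∑-distrib-+; *-distribˡ-sum; sum-replicate-zero)
open import Function.Base using (_∘_)
open import Level using (0ℓ)
open import Relation.Binary.PropositionalEquality
open import Relation.Nullary.Decidable using (yes; no)
open import Relation.Nullary.Negation using (¬_)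
open import Relation.Unary using (Pred; Decidable)
open ≡-Reasoning

-- The equation for γ² is obtained from a differential equation. For r = √(1 + 2w), (1 + 2w) r′ = r
-- gives r² a two-term recurrence with the factor 1 - n, so that r² breaks off after degree 1. The
-- link between B and powers of a series is the multinomial theorem, but B is given by a filtered
-- enumeration of tuples. It is proved one variable at a time, from the nesting y₀ t + y₁ t² + ... =
-- t (y₀ + t (y₁ + ...)). Taking tᵏ out of a k-th power lowers the degree by k, and moving all
-- positions down by one lowers the weight of a tuple by the sum k of its entries; these two shifts
-- match. Divided powers then make splitting off the constant y₀ a plain convolution. Substitution
-- of series respects products by Horner's rule and induction on the degree, without rearranging
-- double sums. The passage from e⁻ᵗ to eᵗ is kept apart as a reflection t ↦ -t, which is the source
-- of the factor (-1)ⁿ.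

private variable
  f f′ g g′ : Series
  X Y Z : Set

-- Arithmetic of formal power series

tailₛ : Series → Series
tailₛ f n = f (suc n)

_+ₛ_ : Series → Series → Series
(f +ₛ g) n = f n + g n

_·ₛ_ : ℚ → Series → Series
(a ·ₛ f) n = a * f n

infixl 6 _+ₛ_
infixl 7 _·ₛ_


-- Inductions on the degree and truncations to polynomials only supply agreement up to degree n,
-- hence the bounded form.
*ₛ-cong-≤ : ∀ n → (∀ {i} → i ≤ n → f i ≡ f′ i) → (∀ {i} → i ≤ n → g i ≡ g′ i) →
            (f *ₛ g) n ≡ (f′ *ₛ g′) n
*ₛ-cong-≤ zero    p q = cong₂ (λ a b → a * b + 0ℚ) (p z≤n) (q z≤n)
*ₛ-cong-≤ (suc n) p q = cong₂ _+_ (cong₂ _*_ (p z≤n) (q ℕ.≤-refl))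
  (*ₛ-cong-≤ n (p ∘ s≤s) (q ∘ ℕ.m≤n⇒m≤1+n))

*ₛ-cong : f ≗ f′ → g ≗ g′ → f *ₛ g ≗ f′ *ₛ g′
*ₛ-cong p q n = *ₛ-cong-≤ n (λ {i} _ → p i) (λ {i} _ → q i)

-- `(f *ₛ g) (suc n)` computes to `f 0 * g (suc n) + (tailₛ f *ₛ g) n`, so laws of the product go by
-- induction on the degree, with the left factor replaced by its tail.
*ₛ-distribʳ-+ : ∀ h f g → (f +ₛ g) *ₛ h ≗ (f *ₛ h) +ₛ (g *ₛ h)
*ₛ-distribʳ-+ h f g zero =
  solve 3 (λ a b c → (a :+ b) :* c :+ con 0ℚ := (a :* c :+ con 0ℚ) :+ (b :* c :+ con 0ℚ)) refl (f 0) (g 0) (h 0)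
*ₛ-distribʳ-+ h f g (suc n) = trans
  (cong ((f 0 + g 0) * h (suc n) +_) (*ₛ-distribʳ-+ h (tailₛ f) (tailₛ g) n))
  (solve 5 (λ a b c d e → (a :+ b) :* c :+ (d :+ e) := (a :* c :+ d) :+ (b :* c :+ e)) refl
    (f 0) (g 0) (h (suc n)) _ _)

·ₛ-*ₛ-assoc : ∀ a f g → (a ·ₛ f) *ₛ g ≗ a ·ₛ (f *ₛ g)
·ₛ-*ₛ-assoc a f g zero =
  solve 3 (λ a b c → (a :* b) :* c :+ con 0ℚ := a :* (b :* c :+ con 0ℚ)) refl a (f 0) (g 0)
·ₛ-*ₛ-assoc a f g (suc n) = trans
  (cong (a * f 0 * g (suc n) +_) (·ₛ-*ₛ-assoc a (tailₛ f) g n))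
  (solve 4 (λ a b c d → (a :* b) :* c :+ a :* d := a :* (b :* c :+ d)) refl a (f 0) (g (suc n)) _)

-- The product computes by splitting off `f 0`. Splitting off `g 0` is the mirror image on which
-- commutativity rests.
*ₛ-snoc : ∀ f g n → (f *ₛ g) (suc n) ≡ (f *ₛ tailₛ g) n + f (suc n) * g 0
*ₛ-snoc f g zero =
  solve 2 (λ a b → a :+ (b :+ con 0ℚ) := (a :+ con 0ℚ) :+ b) refl (f 0 * g 1) (f 1 * g 0)
*ₛ-snoc f g (suc n) = trans
  (cong (f 0 * g (suc (suc n)) +_) (*ₛ-snoc (tailₛ f) g n))
  (sym (ℚ.+-assoc (f 0 * g (suc (suc n))) _ _))

*ₛ-comm : ∀ f g → f *ₛ g ≗ g *ₛ f
*ₛ-comm f g zero    = cong (_+ 0ℚ) (ℚ.*-comm (f 0) (g 0))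
*ₛ-comm f g (suc n) = begin
  (f *ₛ g) (suc n)                        ≡⟨ *ₛ-snoc f g n ⟩
  (f *ₛ tailₛ g) n + f (suc n) * g 0      ≡⟨ cong₂ _+_ (*ₛ-comm f (tailₛ g) n) (ℚ.*-comm (f (suc n)) (g 0)) ⟩
  (tailₛ g *ₛ f) n + g 0 * f (suc n)      ≡⟨ ℚ.+-comm _ (g 0 * f (suc n)) ⟩
  (g *ₛ f) (suc n)                        ∎

*ₛ-assoc : ∀ f g h → (f *ₛ g) *ₛ h ≗ f *ₛ (g *ₛ h)
*ₛ-assoc f g h zero =
  solve 3 (λ a b c → (a :* b :+ con 0ℚ) :* c :+ con 0ℚ := a :* (b :* c :+ con 0ℚ) :+ con 0ℚ) refl (f 0) (g 0) (h 0)
*ₛ-assoc f g h (suc n) = begin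
  -- The tail of `f *ₛ g` computes to `f 0 ·ₛ tailₛ g +ₛ tailₛ f *ₛ g`.
  (f *ₛ g) 0 * h (suc n) + ((f 0 ·ₛ tailₛ g +ₛ tailₛ f *ₛ g) *ₛ h) n
    ≡⟨ cong ((f *ₛ g) 0 * h (suc n) +_) (trans (*ₛ-distribʳ-+ h (f 0 ·ₛ tailₛ g) (tailₛ f *ₛ g) n)
         (cong₂ _+_ (·ₛ-*ₛ-assoc (f 0) (tailₛ g) h n) (*ₛ-assoc (tailₛ f) g h n))) ⟩
  (f *ₛ g) 0 * h (suc n) + (f 0 * (tailₛ g *ₛ h) n + (tailₛ f *ₛ (g *ₛ h)) n)
    ≡⟨ solve 5 (λ a b c d e → (a :* b :+ con 0ℚ) :* c :+ (a :* d :+ e) := a :* (b :* c :+ d) :+ e) refl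
         (f 0) (g 0) (h (suc n)) _ _ ⟩
  (f *ₛ (g *ₛ h)) (suc n) ∎

*ₛ-distribˡ-+ : ∀ f g h → f *ₛ (g +ₛ h) ≗ (f *ₛ g) +ₛ (f *ₛ h)
*ₛ-distribˡ-+ f g h n = begin
  (f *ₛ (g +ₛ h)) n             ≡⟨ *ₛ-comm f (g +ₛ h) n ⟩
  ((g +ₛ h) *ₛ f) n             ≡⟨ *ₛ-distribʳ-+ f g h n ⟩
  (g *ₛ f) n + (h *ₛ f) n       ≡⟨ cong₂ _+_ (*ₛ-comm g f n) (*ₛ-comm h f n) ⟩
  (f *ₛ g) n + (f *ₛ h) n       ∎

*ₛ-·ₛ-assoc : ∀ a f g → f *ₛ (a ·ₛ g) ≗ a ·ₛ (f *ₛ g)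
*ₛ-·ₛ-assoc a f g n = begin
  (f *ₛ (a ·ₛ g)) n   ≡⟨ *ₛ-comm f (a ·ₛ g) n ⟩
  ((a ·ₛ g) *ₛ f) n   ≡⟨ ·ₛ-*ₛ-assoc a g f n ⟩
  a * (g *ₛ f) n      ≡⟨ cong (a *_) (*ₛ-comm g f n) ⟩
  a * (f *ₛ g) n      ∎

0ₛ : Series
0ₛ _ = 0ℚ

*ₛ-zeroˡ : ∀ f → 0ₛ *ₛ f ≗ 0ₛ
-- `0ₛ` is convertible with `0ℚ ·ₛ 0ₛ`, which turns the claim into a scalar multiple by zero.
*ₛ-zeroˡ f n = trans (·ₛ-*ₛ-assoc 0ℚ 0ₛ f n) (ℚ.*-zeroˡ ((0ₛ *ₛ f) n))

*ₛ-zeroʳ : ∀ f → f *ₛ 0ₛ ≗ 0ₛ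
*ₛ-zeroʳ f n = trans (*ₛ-comm f 0ₛ n) (*ₛ-zeroˡ f n)

*ₛ-identityˡ : ∀ f → 1ₛ *ₛ f ≗ f
*ₛ-identityˡ f zero    = trans (ℚ.+-identityʳ (1ℚ * f 0)) (ℚ.*-identityˡ (f 0))
*ₛ-identityˡ f (suc n) = trans (cong₂ _+_ (ℚ.*-identityˡ (f (suc n))) (*ₛ-zeroˡ f n)) (ℚ.+-identityʳ (f (suc n)))

*ₛ-identityʳ : ∀ f → f *ₛ 1ₛ ≗ f
*ₛ-identityʳ f n = trans (*ₛ-comm f 1ₛ n) (*ₛ-identityˡ f n)

sum-zero : ∀ {N} {f : Fin N → ℚ} → (∀ i → f i ≡ 0ℚ) → sum f ≡ 0ℚ
sum-zero {N} p = trans (sum-cong-≗ p) (sum-replicate-zero N)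

*ₛ-∑ : ∀ {N} f (c : Fin N → ℚ) (g : Fin N → Series) →
       f *ₛ (λ n → sum (λ i → c i * g i n)) ≗ λ n → sum (λ i → c i * (f *ₛ g i) n)
*ₛ-∑ {zero}  f c g n = *ₛ-zeroʳ f n
*ₛ-∑ {suc N} f c g n = trans
  (*ₛ-distribˡ-+ f (c fzero ·ₛ g fzero) (λ m → sum (λ i → c (fsuc i) * g (fsuc i) m)) n)
  (cong₂ _+_ (*ₛ-·ₛ-assoc (c fzero) f (g fzero) n) (*ₛ-∑ f (c ∘ fsuc) (g ∘ fsuc) n))

^ₛ-cong-≤ : ∀ n → (∀ {i} → i ≤ n → f i ≡ g i) → ∀ k → (f ^ₛ k) n ≡ (g ^ₛ k) n
^ₛ-cong-≤ n p zero    = refl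
^ₛ-cong-≤ n p (suc k) = *ₛ-cong-≤ n p (λ i≤n → ^ₛ-cong-≤ _ (λ j≤i → p (ℕ.≤-trans j≤i i≤n)) k)

*ₛ-zero : f 0 ≡ 0ℚ → ∀ g → (f *ₛ g) 0 ≡ 0ℚ
*ₛ-zero f₀≡0 g = trans (cong (λ a → a * g 0 + 0ℚ) f₀≡0) (cong (_+ 0ℚ) (ℚ.*-zeroˡ (g 0)))

*ₛ-suc : f 0 ≡ 0ℚ → ∀ g n → (f *ₛ g) (suc n) ≡ (tailₛ f *ₛ g) n
*ₛ-suc {f} f₀≡0 g n = begin
  f 0 * g (suc n) + (tailₛ f *ₛ g) n   ≡⟨ cong (λ a → a * g (suc n) + (tailₛ f *ₛ g) n) f₀≡0 ⟩
  0ℚ * g (suc n) + (tailₛ f *ₛ g) n    ≡⟨ cong (_+ (tailₛ f *ₛ g) n) (ℚ.*-zeroˡ (g (suc n))) ⟩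
  0ℚ + (tailₛ f *ₛ g) n                ≡⟨ ℚ.+-identityˡ ((tailₛ f *ₛ g) n) ⟩
  (tailₛ f *ₛ g) n                     ∎

*ₛ-drop : ∀ k f g → (∀ {i} → i < k → f i ≡ 0ℚ) → ∀ m →
          (f *ₛ g) (k ℕ.+ m) ≡ ((λ i → f (k ℕ.+ i)) *ₛ g) m
*ₛ-drop zero    f g p m = refl
*ₛ-drop (suc k) f g p m = trans (*ₛ-suc {f} (p (s≤s z≤n)) g (k ℕ.+ m)) (*ₛ-drop k (tailₛ f) g (p ∘ s≤s) m)

^ₛ-vanish : f 0 ≡ 0ℚ → ∀ k {n} → n < k → (f ^ₛ k) n ≡ 0ℚ
^ₛ-vanish {f} p (suc k) {zero}  _         = *ₛ-zero {f} p (f ^ₛ k)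
^ₛ-vanish {f} p (suc k) {suc n} (s≤s n<k) = begin
  (f *ₛ (f ^ₛ k)) (suc n)   ≡⟨ *ₛ-suc {f} p (f ^ₛ k) n ⟩
  (tailₛ f *ₛ (f ^ₛ k)) n   ≡⟨ *ₛ-cong-≤ {tailₛ f} n (λ _ → refl) (λ i≤n → ^ₛ-vanish p k (ℕ.≤-<-trans i≤n n<k)) ⟩
  (tailₛ f *ₛ 0ₛ) n         ≡⟨ *ₛ-zeroʳ (tailₛ f) n ⟩
  0ℚ                        ∎

-- For f = t h this is (t h)ᵏ = tᵏ hᵏ, read off in degree k + m.
^ₛ-drop : f 0 ≡ 0ℚ → ∀ k m → (f ^ₛ k) (k ℕ.+ m) ≡ (tailₛ f ^ₛ k) m
^ₛ-drop {f} p zero    m = refl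
^ₛ-drop {f} p (suc k) m = begin
  (f *ₛ (f ^ₛ k)) (suc (k ℕ.+ m))                ≡⟨ *ₛ-suc {f} p (f ^ₛ k) (k ℕ.+ m) ⟩
  (tailₛ f *ₛ (f ^ₛ k)) (k ℕ.+ m)                ≡⟨ *ₛ-comm (tailₛ f) (f ^ₛ k) (k ℕ.+ m) ⟩
  ((f ^ₛ k) *ₛ tailₛ f) (k ℕ.+ m)                ≡⟨ *ₛ-drop k (f ^ₛ k) (tailₛ f) (^ₛ-vanish p k) m ⟩
  ((λ i → (f ^ₛ k) (k ℕ.+ i)) *ₛ tailₛ f) m      ≡⟨ *ₛ-cong {g = tailₛ f} (^ₛ-drop p k) (λ _ → refl) m ⟩
  ((tailₛ f ^ₛ k) *ₛ tailₛ f) m                  ≡⟨ *ₛ-comm (tailₛ f ^ₛ k) (tailₛ f) m ⟩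
  (tailₛ f ^ₛ suc k) m                           ∎

-- Trimming finite sums, and substitution of one series into another

sum-drop : ∀ k {M} (F : ℕ → ℚ) → (∀ {i} → i < k → F i ≡ 0ℚ) →
           sum {k ℕ.+ M} (F ∘ toℕ) ≡ sum {M} (λ i → F (k ℕ.+ toℕ i))
sum-drop zero    F p = refl
sum-drop (suc k) F p = trans (cong₂ _+_ (p (s≤s z≤n)) (sum-drop k (F ∘ suc) (p ∘ s≤s)))
  (ℚ.+-identityˡ _)

sum-take : ∀ N M (F : ℕ → ℚ) → (∀ i → F (N ℕ.+ i) ≡ 0ℚ) →
           sum {N ℕ.+ M} (F ∘ toℕ) ≡ sum {N} (F ∘ toℕ)
sum-take zero    M F p = sum-zero {M} (p ∘ toℕ)
sum-take (suc N) M F p = cong (F 0 +_) (sum-take N M (F ∘ suc) p)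

sum-truncate : ∀ {N M} (F : ℕ → ℚ) → N ≤ M → (∀ {i} → N ≤ i → F i ≡ 0ℚ) →
               sum {M} (F ∘ toℕ) ≡ sum {N} (F ∘ toℕ)
sum-truncate {N} {M} F N≤M p = subst (λ k → sum {k} (F ∘ toℕ) ≡ sum {N} (F ∘ toℕ)) (ℕ.m+[n∸m]≡n N≤M)
  (sum-take N (M ∸ N) F (λ i → p (ℕ.m≤m+n N i)))

-- Meaningful for w 0 ≡ 0ℚ: then w ^ₛ ℓ has no terms of degree below ℓ.
_∘ₛ_ : Series → Series → Series
(g ∘ₛ w) n = ∑[ ℓ ∈ 0 ⋯ n ] g ℓ * (w ^ₛ ℓ) n

infixr 9 _∘ₛ_

module _ {w : Series} (w₀≡0 : w 0 ≡ 0ℚ) where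

  -- The length of the sum defining `g ∘ₛ w` varies with the degree. Terms with ℓ > n vanish, so all
  -- degrees up to N can share one range, as linearity of the product requires.
  ∘ₛ-extend : ∀ g {n N} → n ≤ N → (g ∘ₛ w) n ≡ sum {suc N} (λ ℓ → g (toℕ ℓ) * (w ^ₛ toℕ ℓ) n)
  ∘ₛ-extend g {n} n≤N = sym (sum-truncate (λ ℓ → g ℓ * (w ^ₛ ℓ) n) (s≤s n≤N)
    (λ {ℓ} n<ℓ → trans (cong (g ℓ *_) (^ₛ-vanish w₀≡0 ℓ n<ℓ)) (ℚ.*-zeroʳ (g ℓ))))

  -- Horner's rule g(w) = g(0) + w · (tail of g)(w): a recursion on g in place of the sum over
  -- powers of w.
  ∘ₛ-horner : ∀ g → g ∘ₛ w ≗ (g 0 ·ₛ 1ₛ) +ₛ w *ₛ (tailₛ g ∘ₛ w)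
  ∘ₛ-horner g zero = cong (g 0 * 1ℚ +_) (sym (*ₛ-zero {w} w₀≡0 (tailₛ g ∘ₛ w)))
  ∘ₛ-horner g (suc n) = cong (g 0 * 0ℚ +_) (begin
    sum {suc n} (λ ℓ → g (suc (toℕ ℓ)) * (w *ₛ (w ^ₛ toℕ ℓ)) (suc n))
      ≡⟨ sum-cong-≗ {suc n} (λ ℓ → cong (g (suc (toℕ ℓ)) *_) (*ₛ-suc {w} w₀≡0 (w ^ₛ toℕ ℓ) n)) ⟩
    sum {suc n} (λ ℓ → g (suc (toℕ ℓ)) * (tailₛ w *ₛ (w ^ₛ toℕ ℓ)) n)
      ≡⟨ *ₛ-∑ {suc n} (tailₛ w) (λ ℓ → g (suc (toℕ ℓ))) (λ ℓ → w ^ₛ toℕ ℓ) n ⟨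
    (tailₛ w *ₛ (λ m → sum {suc n} (λ ℓ → g (suc (toℕ ℓ)) * (w ^ₛ toℕ ℓ) m))) n
      ≡⟨ *ₛ-cong-≤ {tailₛ w} n (λ _ → refl) (∘ₛ-extend (tailₛ g)) ⟨
    (tailₛ w *ₛ (tailₛ g ∘ₛ w)) n
      ≡⟨ *ₛ-suc {w} w₀≡0 (tailₛ g ∘ₛ w) n ⟨
    (w *ₛ (tailₛ g ∘ₛ w)) (suc n) ∎)

  ∘ₛ-affine : ∀ a f g → ((a ·ₛ f) +ₛ g) ∘ₛ w ≗ (a ·ₛ (f ∘ₛ w)) +ₛ (g ∘ₛ w)
  ∘ₛ-affine a f g n = begin
    sum {suc n} (λ ℓ → (a * f (toℕ ℓ) + g (toℕ ℓ)) * u ℓ)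
      ≡⟨ sum-cong-≗ {suc n} (λ ℓ → solve 4 (λ a b c d → (a :* b :+ c) :* d := a :* (b :* d) :+ c :* d) refl
           a (f (toℕ ℓ)) (g (toℕ ℓ)) (u ℓ)) ⟩
    sum {suc n} (λ ℓ → a * (f (toℕ ℓ) * u ℓ) + g (toℕ ℓ) * u ℓ)
      ≡⟨ ∑-distrib-+ {suc n} (λ ℓ → a * (f (toℕ ℓ) * u ℓ)) (λ ℓ → g (toℕ ℓ) * u ℓ) ⟩
    sum {suc n} (λ ℓ → a * (f (toℕ ℓ) * u ℓ)) + (g ∘ₛ w) n
      ≡⟨ cong (_+ (g ∘ₛ w) n) (*-distribˡ-sum {suc n} a (λ ℓ → f (toℕ ℓ) * u ℓ)) ⟨
    a * (f ∘ₛ w) n + (g ∘ₛ w) n ∎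
    where
    u : Fin (suc n) → ℚ
    u ℓ = (w ^ₛ toℕ ℓ) n

  -- Horner's rule on both sides leaves the same claim for `tailₛ f`, multiplied by `w`. As `w` has
  -- no constant term, that factor needs the claim in strictly lower degrees only. It needs all of
  -- them, so the induction is on a bound N for the degree.
  ∘ₛ-*ₛ : ∀ f g → (f *ₛ g) ∘ₛ w ≗ (f ∘ₛ w) *ₛ (g ∘ₛ w)
  ∘ₛ-*ₛ f g n = upTo n f ℕ.≤-refl
    where
    upTo : ∀ N f {n} → n ≤ N → ((f *ₛ g) ∘ₛ w) n ≡ ((f ∘ₛ w) *ₛ (g ∘ₛ w)) n

    w*-step : ∀ N f {n} → n ≤ N →
              (w *ₛ ((tailₛ f *ₛ g) ∘ₛ w)) n ≡ (w *ₛ ((tailₛ f ∘ₛ w) *ₛ (g ∘ₛ w))) n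
    w*-step N f {zero} _ = trans
      (*ₛ-zero {w} w₀≡0 ((tailₛ f *ₛ g) ∘ₛ w))
      (sym (*ₛ-zero {w} w₀≡0 ((tailₛ f ∘ₛ w) *ₛ (g ∘ₛ w))))
    w*-step (suc N) f {suc n} (s≤s n≤N) = begin
      (w *ₛ ((tailₛ f *ₛ g) ∘ₛ w)) (suc n)                  ≡⟨ *ₛ-suc {w} w₀≡0 ((tailₛ f *ₛ g) ∘ₛ w) n ⟩
      (tailₛ w *ₛ ((tailₛ f *ₛ g) ∘ₛ w)) n                  ≡⟨ *ₛ-cong-≤ {tailₛ w} n (λ _ → refl)
                                                               (λ i≤n → upTo N (tailₛ f) (ℕ.≤-trans i≤n n≤N)) ⟩
      (tailₛ w *ₛ ((tailₛ f ∘ₛ w) *ₛ (g ∘ₛ w))) n           ≡⟨ *ₛ-suc {w} w₀≡0 ((tailₛ f ∘ₛ w) *ₛ (g ∘ₛ w)) n ⟨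
      (w *ₛ ((tailₛ f ∘ₛ w) *ₛ (g ∘ₛ w))) (suc n)           ∎

    upTo N f {n} n≤N = begin
      ((f *ₛ g) ∘ₛ w) n
        ≡⟨ ∘ₛ-horner (f *ₛ g) n ⟩
      (f 0 * g 0 + 0ℚ) * 1ₛ n + (w *ₛ (tailₛ (f *ₛ g) ∘ₛ w)) n
        ≡⟨ cong ((f 0 * g 0 + 0ℚ) * 1ₛ n +_) (begin
             (w *ₛ (tailₛ (f *ₛ g) ∘ₛ w)) n
               ≡⟨ *ₛ-cong {w} (λ _ → refl) (∘ₛ-affine (f 0) (tailₛ g) (tailₛ f *ₛ g)) n ⟩
             (w *ₛ ((f 0 ·ₛ (tailₛ g ∘ₛ w)) +ₛ ((tailₛ f *ₛ g) ∘ₛ w))) n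
               ≡⟨ *ₛ-distribˡ-+ w (f 0 ·ₛ (tailₛ g ∘ₛ w)) ((tailₛ f *ₛ g) ∘ₛ w) n ⟩
             (w *ₛ (f 0 ·ₛ (tailₛ g ∘ₛ w))) n + (w *ₛ ((tailₛ f *ₛ g) ∘ₛ w)) n
               ≡⟨ cong₂ _+_ (*ₛ-·ₛ-assoc (f 0) w (tailₛ g ∘ₛ w) n) (w*-step N f n≤N) ⟩
             f 0 * (w *ₛ (tailₛ g ∘ₛ w)) n + (w *ₛ ((tailₛ f ∘ₛ w) *ₛ (g ∘ₛ w))) n ∎) ⟩
      (f 0 * g 0 + 0ℚ) * 1ₛ n + (f 0 * (w *ₛ (tailₛ g ∘ₛ w)) n + (w *ₛ ((tailₛ f ∘ₛ w) *ₛ (g ∘ₛ w))) n)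
        ≡⟨ solve 5 (λ a b c d e → (a :* b :+ con 0ℚ) :* c :+ (a :* d :+ e) := a :* (b :* c :+ d) :+ e) refl
             (f 0) (g 0) (1ₛ n) _ _ ⟩
      f 0 * (g 0 * 1ₛ n + (w *ₛ (tailₛ g ∘ₛ w)) n) + (w *ₛ ((tailₛ f ∘ₛ w) *ₛ (g ∘ₛ w))) n
        ≡⟨ cong₂ _+_ (cong (f 0 *_) (sym (∘ₛ-horner g n))) (sym (*ₛ-assoc w (tailₛ f ∘ₛ w) (g ∘ₛ w) n)) ⟩
      f 0 * (g ∘ₛ w) n + ((w *ₛ (tailₛ f ∘ₛ w)) *ₛ (g ∘ₛ w)) n
        ≡⟨ cong (λ a → f 0 * a + ((w *ₛ (tailₛ f ∘ₛ w)) *ₛ (g ∘ₛ w)) n) (*ₛ-identityˡ (g ∘ₛ w) n) ⟨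
      f 0 * (1ₛ *ₛ (g ∘ₛ w)) n + ((w *ₛ (tailₛ f ∘ₛ w)) *ₛ (g ∘ₛ w)) n
        ≡⟨ cong (_+ ((w *ₛ (tailₛ f ∘ₛ w)) *ₛ (g ∘ₛ w)) n) (·ₛ-*ₛ-assoc (f 0) 1ₛ (g ∘ₛ w) n) ⟨
      ((f 0 ·ₛ 1ₛ) *ₛ (g ∘ₛ w)) n + ((w *ₛ (tailₛ f ∘ₛ w)) *ₛ (g ∘ₛ w)) n
        ≡⟨ *ₛ-distribʳ-+ (g ∘ₛ w) (f 0 ·ₛ 1ₛ) (w *ₛ (tailₛ f ∘ₛ w)) n ⟨
      (((f 0 ·ₛ 1ₛ) +ₛ w *ₛ (tailₛ f ∘ₛ w)) *ₛ (g ∘ₛ w)) n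
        ≡⟨ *ₛ-cong {g = g ∘ₛ w} (∘ₛ-horner f) (λ _ → refl) n ⟨
      ((f ∘ₛ w) *ₛ (g ∘ₛ w)) n ∎

  ∘ₛ-1ₛ : 1ₛ ∘ₛ w ≗ 1ₛ
  ∘ₛ-1ₛ n = begin
    1ℚ * 1ₛ n + sum {n} (λ ℓ → 0ℚ * (w ^ₛ suc (toℕ ℓ)) n)
      ≡⟨ cong₂ _+_ (ℚ.*-identityˡ (1ₛ n)) (sum-zero {n} (λ ℓ → ℚ.*-zeroˡ ((w ^ₛ suc (toℕ ℓ)) n))) ⟩
    1ₛ n + 0ℚ ≡⟨ ℚ.+-identityʳ (1ₛ n) ⟩
    1ₛ n ∎

  ∘ₛ-^ₛ : ∀ f k → (f ^ₛ k) ∘ₛ w ≗ (f ∘ₛ w) ^ₛ k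
  ∘ₛ-^ₛ f zero    = ∘ₛ-1ₛ
  ∘ₛ-^ₛ f (suc k) n = trans (∘ₛ-*ₛ f (f ^ₛ k) n) (*ₛ-cong {f ∘ₛ w} (λ _ → refl) (∘ₛ-^ₛ f k) n)

-- Natural numbers and inverse factorials as rationals

-- Rationals are kept in lowest terms, which obscures computation with variables. On unnormalised
-- fractions the laws of `fromℕ` become integer identities, and they are carried over along
-- `fromℚᵘ`.
fromℚᵘ-homo-+ : ∀ p q → fromℚᵘ (p ℚᵘ.+ q) ≡ fromℚᵘ p + fromℚᵘ q
fromℚᵘ-homo-+ p q = ℚ.toℚᵘ-injective (ℚᵘ.≃-trans (ℚ.toℚᵘ-fromℚᵘ (p ℚᵘ.+ q)) (ℚᵘ.≃-sym
  (ℚᵘ.≃-trans (ℚ.toℚᵘ-homo-+ (fromℚᵘ p) (fromℚᵘ q)) (ℚᵘ.+-cong (ℚ.toℚᵘ-fromℚᵘ p) (ℚ.toℚᵘ-fromℚᵘ q)))))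

fromℚᵘ-homo-* : ∀ p q → fromℚᵘ (p ℚᵘ.* q) ≡ fromℚᵘ p * fromℚᵘ q
fromℚᵘ-homo-* p q = ℚ.toℚᵘ-injective (ℚᵘ.≃-trans (ℚ.toℚᵘ-fromℚᵘ (p ℚᵘ.* q)) (ℚᵘ.≃-sym
  (ℚᵘ.≃-trans (ℚ.toℚᵘ-homo-* (fromℚᵘ p) (fromℚᵘ q)) (ℚᵘ.*-cong (ℚ.toℚᵘ-fromℚᵘ p) (ℚ.toℚᵘ-fromℚᵘ q)))))

fromℕ-+ : ∀ m n → fromℕ (m ℕ.+ n) ≡ fromℕ m + fromℕ n
fromℕ-+ m n = trans
  (ℚ.fromℚᵘ-cong {mkℚᵘ (ℤ.+ (m ℕ.+ n)) 0} {mkℚᵘ (ℤ.+ m) 0 ℚᵘ.+ mkℚᵘ (ℤ.+ n) 0}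
    (*≡* (cong (ℤ._* ℤ.1ℤ) (sym (cong₂ ℤ._+_ (ℤ.*-identityʳ (ℤ.+ m)) (ℤ.*-identityʳ (ℤ.+ n)))))))
  (fromℚᵘ-homo-+ (mkℚᵘ (ℤ.+ m) 0) (mkℚᵘ (ℤ.+ n) 0))

fromℕ-* : ∀ m n → fromℕ (m ℕ.* n) ≡ fromℕ m * fromℕ n
fromℕ-* m n = trans
  (cong (λ z → z / 1) (ℤ.pos-* m n))
  (fromℚᵘ-homo-* (mkℚᵘ (ℤ.+ m) 0) (mkℚᵘ (ℤ.+ n) 0))

fromℕ-inverse : ∀ n .{{_ : ℕ.NonZero n}} → fromℕ n * (ℤ.+ 1 / n) ≡ 1ℚ
fromℕ-inverse (suc n) = trans
  (sym (fromℚᵘ-homo-* (mkℚᵘ (ℤ.+ suc n) 0) (mkℚᵘ (ℤ.+ 1) n)))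
  (ℚ.fromℚᵘ-cong {mkℚᵘ (ℤ.+ suc n) 0 ℚᵘ.* mkℚᵘ (ℤ.+ 1) n} {mkℚᵘ (ℤ.+ 1) 0}
    (*≡* (trans (ℤ.*-comm (ℤ.+ suc n ℤ.* ℤ.1ℤ) ℤ.1ℤ)
      (cong (ℤ.1ℤ ℤ.*_) (trans (ℤ.*-comm (ℤ.+ suc n) ℤ.1ℤ) (sym (ℤ.pos-* 1 (suc n))))))))

fromℕ-cancelˡ : ∀ n .{{_ : ℕ.NonZero n}} {a b} → fromℕ n * a ≡ fromℕ n * b → a ≡ b
fromℕ-cancelˡ n {a} {b} eq = trans (sym (undo a)) (trans (cong ((ℤ.+ 1 / n) *_) eq) (undo b))
  where
  undo : ∀ c → (ℤ.+ 1 / n) * (fromℕ n * c) ≡ c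
  undo c = trans (solve 3 (λ a b c → a :* (b :* c) := (b :* a) :* c) refl (ℤ.+ 1 / n) (fromℕ n) c)
    (trans (cong (_* c) (fromℕ-inverse n)) (ℚ.*-identityˡ c))

n!*1/fact : ∀ n → fromℕ (n !) * 1/fact n ≡ 1ℚ
n!*1/fact n = fromℕ-inverse (n !) {{n ℕ.!≢0}}

suc*1/fact : ∀ n → fromℕ (suc n) * 1/fact (suc n) ≡ 1/fact n
suc*1/fact n = fromℕ-cancelˡ (n !) {{n ℕ.!≢0}} (begin
  fromℕ (n !) * (fromℕ (suc n) * 1/fact (suc n))
    ≡⟨ solve 3 (λ a b c → a :* (b :* c) := (b :* a) :* c) refl (fromℕ (n !)) (fromℕ (suc n)) (1/fact (suc n)) ⟩
  fromℕ (suc n) * fromℕ (n !) * 1/fact (suc n)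
    ≡⟨ cong (_* 1/fact (suc n)) (fromℕ-* (suc n) (n !)) ⟨
  fromℕ (suc n !) * 1/fact (suc n)
    ≡⟨ n!*1/fact (suc n) ⟩
  1ℚ
    ≡⟨ n!*1/fact n ⟨
  fromℕ (n !) * 1/fact n ∎)

-- The generating function γ

2ℚ -1ℚ : ℚ
2ℚ  = fromℕ 2
-1ℚ = - 1ℚ

-- The Euler operator w d/dw. It is a derivation like d/dw but preserves degrees, so its product
-- rule has no index shift; `tailₛ (θ f)` is the ordinary derivative.
θ : Series → Series
θ f n = fromℕ n * f n

θ-suc : ∀ f n → θ f (suc n) ≡ tailₛ f n + θ (tailₛ f) n
θ-suc f n = trans (cong (_* f (suc n)) (fromℕ-+ 1 n))
  (solve 2 (λ a b → (con 1ℚ :+ a) :* b := b :+ a :* b) refl (fromℕ n) (f (suc n)))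

θ-*ₛ : ∀ f g → θ (f *ₛ g) ≗ θ f *ₛ g +ₛ f *ₛ θ g
θ-*ₛ f g zero =
  solve 2 (λ a b → con 0ℚ :* (a :* b :+ con 0ℚ) := ((con 0ℚ :* a) :* b :+ con 0ℚ) :+ (a :* (con 0ℚ :* b) :+ con 0ℚ))
    refl (f 0) (g 0)
θ-*ₛ f g (suc n) = begin
  fromℕ (suc n) * (f 0 * g (suc n) + c)
    ≡⟨ ℚ.*-distribˡ-+ (fromℕ (suc n)) (f 0 * g (suc n)) c ⟩
  fromℕ (suc n) * (f 0 * g (suc n)) + fromℕ (suc n) * c
    ≡⟨ cong (fromℕ (suc n) * (f 0 * g (suc n)) +_) (begin
         fromℕ (suc n) * c           ≡⟨ cong (_* c) (fromℕ-+ 1 n) ⟩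
         (1ℚ + fromℕ n) * c          ≡⟨ solve 2 (λ a b → (con 1ℚ :+ a) :* b := b :+ a :* b) refl (fromℕ n) c ⟩
         c + θ (tailₛ f *ₛ g) n      ≡⟨ cong (c +_) (θ-*ₛ (tailₛ f) g n) ⟩
         c + (d + e)                 ∎) ⟩
  fromℕ (suc n) * (f 0 * g (suc n)) + (c + (d + e))
    ≡⟨ solve 6 (λ k a b c d e → k :* (a :* b) :+ (c :+ (d :+ e)) :=
         ((con 0ℚ :* a) :* b :+ (c :+ d)) :+ (a :* (k :* b) :+ e)) refl (fromℕ (suc n)) (f 0) (g (suc n)) c d e ⟩
  (θ f 0 * g (suc n) + (c + d)) + (f *ₛ θ g) (suc n)
    ≡⟨ cong (λ a → (θ f 0 * g (suc n) + a) + (f *ₛ θ g) (suc n)) (begin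
         c + d                                         ≡⟨ *ₛ-distribʳ-+ g (tailₛ f) (θ (tailₛ f)) n ⟨
         ((tailₛ f +ₛ θ (tailₛ f)) *ₛ g) n             ≡⟨ *ₛ-cong {g = g} (θ-suc f) (λ _ → refl) n ⟨
         (tailₛ (θ f) *ₛ g) n                          ∎) ⟩
  (θ f *ₛ g) (suc n) + (f *ₛ θ g) (suc n) ∎
  where
  c d e : ℚ
  c = (tailₛ f *ₛ g) n
  d = (θ (tailₛ f) *ₛ g) n
  e = (tailₛ f *ₛ θ g) n

sign : ℕ → ℚ
sign n = -1ℚ ^ n

-- γ; up to signs and powers of 2 its coefficients are the Catalan numbers.
catalan : Series
catalan d = sign (suc d) * (fromℕ (odd!! d) * 1/fact (suc d))

-- The ratio of consecutive coefficients, from the recursion of the double factorial; the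
-- differential equation of `sqrt` is this ratio in disguise.
catalan-suc : ∀ d → fromℕ (suc (suc d)) * catalan (suc d) ≡ -1ℚ * (fromℕ (suc (2 ℕ.* d)) * catalan d)
catalan-suc d = begin
  fromℕ (suc (suc d)) * (-1ℚ * sign (suc d) * (fromℕ (odd!! (suc d)) * 1/fact (suc (suc d))))
    ≡⟨ cong (λ a → fromℕ (suc (suc d)) * (-1ℚ * sign (suc d) * (a * 1/fact (suc (suc d)))))
         (fromℕ-* (suc (2 ℕ.* d)) (odd!! d)) ⟩
  fromℕ (suc (suc d)) * (-1ℚ * sign (suc d) * (o * fromℕ (odd!! d) * 1/fact (suc (suc d))))
    ≡⟨ solve 6 (λ n m s o p q → n :* (m :* s :* (o :* p :* q)) := m :* (o :* (s :* (p :* (n :* q))))) refl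
         (fromℕ (suc (suc d))) -1ℚ (sign (suc d)) o (fromℕ (odd!! d)) (1/fact (suc (suc d))) ⟩
  -1ℚ * (o * (sign (suc d) * (fromℕ (odd!! d) * (fromℕ (suc (suc d)) * 1/fact (suc (suc d))))))
    ≡⟨ cong (λ a → -1ℚ * (o * (sign (suc d) * (fromℕ (odd!! d) * a)))) (suc*1/fact (suc d)) ⟩
  -1ℚ * (o * catalan d) ∎
  where
  o : ℚ
  o = fromℕ (suc (2 ℕ.* d))

-- √(1 + 2w)
sqrt : Series
sqrt zero    = 1ℚ
sqrt (suc n) = -1ℚ * catalan n

-- (1 + 2w) r′ = r for r = √(1 + 2w)
θ-sqrt : tailₛ (θ sqrt) ≗ sqrt +ₛ ((- 2ℚ) ·ₛ θ sqrt)
θ-sqrt zero    = refl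
θ-sqrt (suc d) = begin
  fromℕ (suc (suc d)) * (-1ℚ * catalan (suc d))
    ≡⟨ solve 2 (λ a b → a :* (con -1ℚ :* b) := con -1ℚ :* (a :* b)) refl (fromℕ (suc (suc d))) (catalan (suc d)) ⟩
  -1ℚ * (fromℕ (suc (suc d)) * catalan (suc d))
    ≡⟨ cong (-1ℚ *_) (trans (catalan-suc d) (cong (λ a → -1ℚ * (a * catalan d))
         (trans (fromℕ-+ 1 (2 ℕ.* d)) (cong (1ℚ +_) (fromℕ-* 2 d))))) ⟩
  -1ℚ * (-1ℚ * ((1ℚ + 2ℚ * fromℕ d) * catalan d))
    ≡⟨ solve 2 (λ n c → con -1ℚ :* (con -1ℚ :* ((con 1ℚ :+ con 2ℚ :* n) :* c)) :=
         con -1ℚ :* c :+ con (- 2ℚ) :* ((con 1ℚ :+ n) :* (con -1ℚ :* c))) refl (fromℕ d) (catalan d) ⟩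
  -1ℚ * catalan d + (- 2ℚ) * ((1ℚ + fromℕ d) * (-1ℚ * catalan d))
    ≡⟨ cong (λ a → -1ℚ * catalan d + (- 2ℚ) * (a * (-1ℚ * catalan d))) (fromℕ-+ 1 d) ⟨
  (sqrt +ₛ ((- 2ℚ) ·ₛ θ sqrt)) (suc d) ∎

sqrt² : Series
sqrt² = sqrt *ₛ sqrt

θ-sqrt² : θ sqrt² ≗ 2ℚ ·ₛ (θ sqrt *ₛ sqrt)
θ-sqrt² n = begin
  θ sqrt² n                                        ≡⟨ θ-*ₛ sqrt sqrt n ⟩
  (θ sqrt *ₛ sqrt) n + (sqrt *ₛ θ sqrt) n          ≡⟨ cong ((θ sqrt *ₛ sqrt) n +_) (*ₛ-comm sqrt (θ sqrt) n) ⟩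
  (θ sqrt *ₛ sqrt) n + (θ sqrt *ₛ sqrt) n          ≡⟨ solve 1 (λ a → a :+ a := con 2ℚ :* a) refl ((θ sqrt *ₛ sqrt) n) ⟩
  2ℚ * (θ sqrt *ₛ sqrt) n                          ∎

-- From (1 + 2w) r′ = r, the square s = r² satisfies (1 + 2w) s′ = 2s; this is its coefficient in
-- degree n.
sqrt²-suc : ∀ n → fromℕ (suc n) * sqrt² (suc n) ≡ 2ℚ * ((1ℚ + - fromℕ n) * sqrt² n)
sqrt²-suc n = begin
  θ sqrt² (suc n)
    ≡⟨ θ-sqrt² (suc n) ⟩
  2ℚ * (θ sqrt *ₛ sqrt) (suc n)
    ≡⟨ cong (2ℚ *_) (*ₛ-suc {θ sqrt} refl sqrt n) ⟩
  2ℚ * (tailₛ (θ sqrt) *ₛ sqrt) n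
    ≡⟨ cong (2ℚ *_) (*ₛ-cong {g = sqrt} θ-sqrt (λ _ → refl) n) ⟩
  2ℚ * ((sqrt +ₛ ((- 2ℚ) ·ₛ θ sqrt)) *ₛ sqrt) n
    ≡⟨ cong (2ℚ *_) (*ₛ-distribʳ-+ sqrt sqrt ((- 2ℚ) ·ₛ θ sqrt) n) ⟩
  2ℚ * (sqrt² n + (((- 2ℚ) ·ₛ θ sqrt) *ₛ sqrt) n)
    ≡⟨ cong (λ a → 2ℚ * (sqrt² n + a)) (·ₛ-*ₛ-assoc (- 2ℚ) (θ sqrt) sqrt n) ⟩
  2ℚ * (sqrt² n + (- 2ℚ) * (θ sqrt *ₛ sqrt) n)
    ≡⟨ solve 2 (λ a b → con 2ℚ :* (a :+ con (- 2ℚ) :* b) := con 2ℚ :* (a :+ :- (con 2ℚ :* b))) refl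
         (sqrt² n) ((θ sqrt *ₛ sqrt) n) ⟩
  2ℚ * (sqrt² n + - (2ℚ * (θ sqrt *ₛ sqrt) n))
    ≡⟨ cong (λ a → 2ℚ * (sqrt² n + - a)) (θ-sqrt² n) ⟨
  2ℚ * (sqrt² n + - (fromℕ n * sqrt² n))
    ≡⟨ solve 2 (λ a b → con 2ℚ :* (a :+ :- (b :* a)) := con 2ℚ :* ((con 1ℚ :+ :- b) :* a)) refl
         (sqrt² n) (fromℕ n) ⟩
  2ℚ * ((1ℚ + - fromℕ n) * sqrt² n) ∎

-- The factor 1 - n is zero at n = 1, so degree 2 vanishes (checked here by evaluation); the
-- recurrence passes the zero on to every later degree.
sqrt²-vanish : ∀ n → sqrt² (suc (suc n)) ≡ 0ℚ
sqrt²-vanish zero    = refl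
sqrt²-vanish (suc n) = fromℕ-cancelˡ (suc (suc (suc n))) (begin
  fromℕ (suc (suc (suc n))) * sqrt² (suc (suc (suc n)))
    ≡⟨ sqrt²-suc (suc (suc n)) ⟩
  2ℚ * ((1ℚ + - fromℕ (suc (suc n))) * sqrt² (suc (suc n)))
    ≡⟨ cong (λ a → 2ℚ * ((1ℚ + - fromℕ (suc (suc n))) * a)) (sqrt²-vanish n) ⟩
  2ℚ * ((1ℚ + - fromℕ (suc (suc n))) * 0ℚ)
    ≡⟨ solve 2 (λ a b → con 2ℚ :* ((con 1ℚ :+ :- a) :* con 0ℚ) := b :* con 0ℚ) refl
         (fromℕ (suc (suc n))) (fromℕ (suc (suc (suc n)))) ⟩
  fromℕ (suc (suc (suc n))) * 0ℚ ∎)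

-- Substituting r = 1 - w γ in r² = 1 + 2w
catalan² : catalan *ₛ catalan ≗ 2ℚ ·ₛ tailₛ catalan
catalan² n = begin
  (catalan *ₛ catalan) n
    ≡⟨ solve 2 (λ s c → s := (con 1ℚ :* (con -1ℚ :* c) :+ (con -1ℚ :* (con -1ℚ :* s) :+ (con -1ℚ :* c) :* con 1ℚ)) :+ con 2ℚ :* c)
         refl ((catalan *ₛ catalan) n) c ⟩
  -- The two cross terms -c of `sqrt²` in degree n + 2 are inserted and compensated by 2c; that 2c
  -- is what remains once the coefficient of `sqrt²` vanishes.
  (1ℚ * (-1ℚ * c) + (-1ℚ * (-1ℚ * (catalan *ₛ catalan) n) + (-1ℚ * c) * 1ℚ)) + 2ℚ * c
    ≡⟨ cong (λ a → (1ℚ * (-1ℚ * c) + (a + (-1ℚ * c) * 1ℚ)) + 2ℚ * c)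
         (trans (·ₛ-*ₛ-assoc -1ℚ catalan (tailₛ sqrt) n) (cong (-1ℚ *_) (*ₛ-·ₛ-assoc -1ℚ catalan catalan n))) ⟨
  (1ℚ * (-1ℚ * c) + ((tailₛ sqrt *ₛ tailₛ sqrt) n + (-1ℚ * c) * 1ℚ)) + 2ℚ * c
    ≡⟨ cong (λ a → (1ℚ * (-1ℚ * c) + a) + 2ℚ * c) (*ₛ-snoc (tailₛ sqrt) sqrt n) ⟨
  sqrt² (suc (suc n)) + 2ℚ * c
    ≡⟨ cong (_+ 2ℚ * c) (sqrt²-vanish n) ⟩
  0ℚ + 2ℚ * c
    ≡⟨ ℚ.+-identityˡ (2ℚ * c) ⟩
  2ℚ * c ∎
  where
  c : ℚ
  c = catalan (suc n)

-- Closed form of the powers of γ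

-- Multiply the equation for γ² by γᵏ. The second term enters with a plus sign because γ(0) = -1.
catalan-^-rec : ∀ k d → (catalan ^ₛ suc (suc k)) d ≡ 2ℚ * (catalan ^ₛ suc k) (suc d) + 2ℚ * (catalan ^ₛ k) (suc d)
catalan-^-rec k d = begin
  (catalan *ₛ (catalan *ₛ h)) d
    ≡⟨ *ₛ-assoc catalan catalan h d ⟨
  ((catalan *ₛ catalan) *ₛ h) d
    ≡⟨ *ₛ-cong {g = h} catalan² (λ _ → refl) d ⟩
  ((2ℚ ·ₛ tailₛ catalan) *ₛ h) d
    ≡⟨ ·ₛ-*ₛ-assoc 2ℚ (tailₛ catalan) h d ⟩
  2ℚ * (tailₛ catalan *ₛ h) d
    ≡⟨ solve 2 (λ a b → con 2ℚ :* a := con 2ℚ :* (con -1ℚ :* b :+ a) :+ con 2ℚ :* b) refl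
         ((tailₛ catalan *ₛ h) d) (h (suc d)) ⟩
  2ℚ * (catalan *ₛ h) (suc d) + 2ℚ * h (suc d) ∎
  where
  h : Series
  h = catalan ^ₛ k

-- (k + 1) C(n, k+1) = (n - k) C(n, k), moved around so that no subtraction occurs.
C-absorption : ∀ n k → suc k ℕ.* (n C suc k) ℕ.+ k ℕ.* (n C k) ≡ n ℕ.* (n C k)
C-absorption zero    zero    = refl
C-absorption zero    (suc k) = cong₂ ℕ._+_ (ℕ.*-zeroʳ k) (ℕ.*-zeroʳ k)
C-absorption (suc n) zero    = trans (ℕ.+-identityʳ _) (trans (ℕ.*-identityˡ _)
  (trans (nC1≡n (suc n)) (sym (ℕ.*-identityʳ (suc n)))))
C-absorption (suc n) (suc k) = begin
  suc (suc k) ℕ.* (suc n C suc (suc k)) ℕ.+ suc k ℕ.* (suc n C suc k)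
    ≡⟨ cong₂ (λ a b → suc (suc k) ℕ.* a ℕ.+ suc k ℕ.* b)
         (nCk+nC[k+1]≡[n+1]C[k+1] n (suc k)) (nCk+nC[k+1]≡[n+1]C[k+1] n k) ⟨
  suc (suc k) ℕ.* (b ℕ.+ c) ℕ.+ suc k ℕ.* (a ℕ.+ b)
    ≡⟨ solve-ℕ 4 (λ k a b c → (con-ℕ 2 ⊕ k) ⊗ (b ⊕ c) ⊕ (con-ℕ 1 ⊕ k) ⊗ (a ⊕ b) ⊜
         ((con-ℕ 2 ⊕ k) ⊗ c ⊕ (con-ℕ 1 ⊕ k) ⊗ b) ⊕ ((con-ℕ 1 ⊕ k) ⊗ b ⊕ k ⊗ a) ⊕ (a ⊕ b)) refl k a b c ⟩
  (suc (suc k) ℕ.* c ℕ.+ suc k ℕ.* b) ℕ.+ (suc k ℕ.* b ℕ.+ k ℕ.* a) ℕ.+ (a ℕ.+ b)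
    ≡⟨ cong₂ (λ x y → x ℕ.+ y ℕ.+ (a ℕ.+ b)) (C-absorption n (suc k)) (C-absorption n k) ⟩
  n ℕ.* b ℕ.+ n ℕ.* a ℕ.+ (a ℕ.+ b)
    ≡⟨ solve-ℕ 3 (λ n a b → n ⊗ b ⊕ n ⊗ a ⊕ (a ⊕ b) ⊜ (con-ℕ 1 ⊕ n) ⊗ (a ⊕ b)) refl n a b ⟩
  suc n ℕ.* (a ℕ.+ b)
    ≡⟨ cong (suc n ℕ.*_) (nCk+nC[k+1]≡[n+1]C[k+1] n k) ⟩
  suc n ℕ.* (suc n C suc k) ∎
  where
  a b c : ℕ
  a = n C k
  b = n C suc k
  c = n C suc (suc k)

-- P (k + d) k; only at k = d = 0 is the subtraction truncated.
Pℕ : ℕ → ℕ → ℕ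
Pℕ k d = k ! ℕ.* odd!! d ℕ.* ((k ℕ.+ 2 ℕ.* d ∸ 1) C (2 ℕ.* d))

-- This is `catalan-^-rec` with the closed form inserted and the negative term moved to the left, to
-- stay in ℕ. All binomials reduce to the neighbours a, b, c of row k + 2d + 1: a and c occur
-- directly, and b + c arises by Pascal's rule. Absorption ties them together by (2d + 1) b = (k +
-- 1) a and (2d + 2) c = k b.
Pℕ-rec : ∀ k d → Pℕ (suc (suc k)) d ℕ.+ 2 ℕ.* (suc (suc (k ℕ.+ d)) ℕ.* Pℕ k (suc d)) ≡ 2 ℕ.* Pℕ (suc k) (suc d)
Pℕ-rec k d = begin
  Pℕ (suc (suc k)) d ℕ.+ 2 ℕ.* (suc (suc (k ℕ.+ d)) ℕ.* Pℕ k (suc d))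
    ≡⟨ cong (λ j → Pℕ (suc (suc k)) d ℕ.+ 2 ℕ.* (suc (suc (k ℕ.+ d)) ℕ.* (k ! ℕ.* odd!! (suc d) ℕ.* ((k ℕ.+ j ∸ 1) C j)))) 2[1+d] ⟩
  Pℕ (suc (suc k)) d ℕ.+ 2 ℕ.* (suc (suc (k ℕ.+ d)) ℕ.* (k ! ℕ.* odd!! (suc d) ℕ.* ((k ℕ.+ suc (suc e) ∸ 1) C suc (suc e))))
    -- `k + suc (suc e) ∸ 1` is stuck on the variable k; with the successors in front the
    -- subtraction computes.
    ≡⟨ cong (λ m → Pℕ (suc (suc k)) d ℕ.+ 2 ℕ.* (suc (suc (k ℕ.+ d)) ℕ.* (k ! ℕ.* odd!! (suc d) ℕ.* ((m ∸ 1) C suc (suc e))))) k+2+e ⟩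
  Pℕ (suc (suc k)) d ℕ.+ 2 ℕ.* (suc (suc (k ℕ.+ d)) ℕ.* (k ! ℕ.* odd!! (suc d) ℕ.* c))
    -- 2(k + d + 2) is split into 2(k + 1) and 2d + 2, so that the last summand contains (2d + 2) c,
    -- ready for `c-b`.
    ≡⟨ solve-ℕ 6 (λ k d f o a c → (con-ℕ 2 ⊕ k) ⊗ ((con-ℕ 1 ⊕ k) ⊗ f) ⊗ o ⊗ a ⊕
           con-ℕ 2 ⊗ ((con-ℕ 2 ⊕ (k ⊕ d)) ⊗ (f ⊗ ((con-ℕ 1 ⊕ con-ℕ 2 ⊗ d) ⊗ o) ⊗ c)) ⊜
         f ⊗ o ⊗ ((con-ℕ 2 ⊕ k) ⊗ ((con-ℕ 1 ⊕ k) ⊗ a) ⊕ con-ℕ 2 ⊗ (con-ℕ 1 ⊕ k) ⊗ ((con-ℕ 1 ⊕ con-ℕ 2 ⊗ d) ⊗ c) ⊕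
           (con-ℕ 1 ⊕ con-ℕ 2 ⊗ d) ⊗ ((con-ℕ 2 ⊕ con-ℕ 2 ⊗ d) ⊗ c))) refl k d (k !) (odd!! d) a c ⟩
  k ! ℕ.* odd!! d ℕ.* (suc (suc k) ℕ.* (suc k ℕ.* a) ℕ.+ 2 ℕ.* suc k ℕ.* (suc e ℕ.* c) ℕ.+ suc e ℕ.* (suc (suc e) ℕ.* c))
    ≡⟨ cong₂ (λ u v → k ! ℕ.* odd!! d ℕ.* (suc (suc k) ℕ.* u ℕ.+ 2 ℕ.* suc k ℕ.* (suc e ℕ.* c) ℕ.+ suc e ℕ.* v))
         (sym b-a) c-b ⟩
  k ! ℕ.* odd!! d ℕ.* (suc (suc k) ℕ.* (suc e ℕ.* b) ℕ.+ 2 ℕ.* suc k ℕ.* (suc e ℕ.* c) ℕ.+ suc e ℕ.* (k ℕ.* b))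
    ≡⟨ solve-ℕ 6 (λ k e f o b c →
         f ⊗ o ⊗ ((con-ℕ 2 ⊕ k) ⊗ ((con-ℕ 1 ⊕ e) ⊗ b) ⊕ con-ℕ 2 ⊗ (con-ℕ 1 ⊕ k) ⊗ ((con-ℕ 1 ⊕ e) ⊗ c) ⊕
           (con-ℕ 1 ⊕ e) ⊗ (k ⊗ b)) ⊜
         con-ℕ 2 ⊗ ((con-ℕ 1 ⊕ k) ⊗ f ⊗ ((con-ℕ 1 ⊕ e) ⊗ o) ⊗ (b ⊕ c))) refl k e (k !) (odd!! d) b c ⟩
  2 ℕ.* (suc k ! ℕ.* odd!! (suc d) ℕ.* (b ℕ.+ c))
    ≡⟨ cong (λ u → 2 ℕ.* (suc k ! ℕ.* odd!! (suc d) ℕ.* u)) (nCk+nC[k+1]≡[n+1]C[k+1] (suc (k ℕ.+ e)) (suc e)) ⟩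
  2 ℕ.* (suc k ! ℕ.* odd!! (suc d) ℕ.* (suc (suc (k ℕ.+ e)) C suc (suc e)))
    ≡⟨ cong (λ m → 2 ℕ.* (suc k ! ℕ.* odd!! (suc d) ℕ.* (m C suc (suc e)))) k+2+e ⟨
  2 ℕ.* (suc k ! ℕ.* odd!! (suc d) ℕ.* ((k ℕ.+ suc (suc e)) C suc (suc e)))
    ≡⟨ cong (λ j → 2 ℕ.* (suc k ! ℕ.* odd!! (suc d) ℕ.* ((k ℕ.+ j) C j))) 2[1+d] ⟨
  2 ℕ.* Pℕ (suc k) (suc d) ∎
  where
  e a b c : ℕ
  e = 2 ℕ.* d
  a = suc (k ℕ.+ e) C e
  b = suc (k ℕ.+ e) C suc e
  c = suc (k ℕ.+ e) C suc (suc e)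

  2[1+d] : 2 ℕ.* suc d ≡ suc (suc e)
  2[1+d] = ℕ.*-suc 2 d

  k+2+e : k ℕ.+ suc (suc e) ≡ suc (suc (k ℕ.+ e))
  k+2+e = trans (ℕ.+-suc k (suc e)) (cong suc (ℕ.+-suc k e))

  b-a : suc e ℕ.* b ≡ suc k ℕ.* a
  b-a = ℕ.+-cancelʳ-≡ (e ℕ.* a) _ _ (trans (C-absorption (suc (k ℕ.+ e)) e) (ℕ.*-distribʳ-+ a (suc k) e))

  c-b : suc (suc e) ℕ.* c ≡ k ℕ.* b
  c-b = ℕ.+-cancelʳ-≡ (suc e ℕ.* b) _ _ (trans (C-absorption (suc (k ℕ.+ e)) (suc e))
    (trans (cong (ℕ._* b) (sym (ℕ.+-suc k e))) (ℕ.*-distribʳ-+ b k (suc e))))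

P≡Pℕ : ∀ k d → P (k ℕ.+ d) k ≡ fromℕ (Pℕ k d)
P≡Pℕ k d = begin
  P (k ℕ.+ d) k
    ≡⟨ cong₂ (λ i n → fromℕ (k !) * fromℕ (odd!! i) * fromℕ ((n ∸ 1) C (2 ℕ.* i))) (ℕ.m+n∸m≡n k d) 2[k+d]∸k ⟩
  fromℕ (k !) * fromℕ (odd!! d) * fromℕ ((k ℕ.+ 2 ℕ.* d ∸ 1) C (2 ℕ.* d))
    ≡⟨ cong (_* fromℕ ((k ℕ.+ 2 ℕ.* d ∸ 1) C (2 ℕ.* d))) (fromℕ-* (k !) (odd!! d)) ⟨
  fromℕ (k ! ℕ.* odd!! d) * fromℕ ((k ℕ.+ 2 ℕ.* d ∸ 1) C (2 ℕ.* d))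
    ≡⟨ fromℕ-* (k ! ℕ.* odd!! d) ((k ℕ.+ 2 ℕ.* d ∸ 1) C (2 ℕ.* d)) ⟨
  fromℕ (Pℕ k d) ∎
  where
  2[k+d]∸k : 2 ℕ.* (k ℕ.+ d) ∸ k ≡ k ℕ.+ 2 ℕ.* d
  2[k+d]∸k = trans
    (cong (_∸ k) (solve-ℕ 2 (λ k d → con-ℕ 2 ⊗ (k ⊕ d) ⊜ k ⊕ (k ⊕ con-ℕ 2 ⊗ d)) refl k d))
    (ℕ.m+n∸m≡n k (k ℕ.+ 2 ℕ.* d))

-- The recurrence lowers the power and raises the degree, so the induction is on k in steps of two,
-- with d arbitrary.
catalan-^ : ∀ k d → (catalan ^ₛ k) d ≡ sign (k ℕ.+ d) * (fromℕ (Pℕ k d) * 1/fact (k ℕ.+ d))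
catalan-^ zero zero    = refl
-- Here the binomial is C(2d + 1, 2d + 2) = 0, in accordance with γ⁰ = 1.
catalan-^ zero (suc d) = sym (begin
  sign (suc d) * (fromℕ (Pℕ 0 (suc d)) * 1/fact (suc d))
    ≡⟨ cong (λ c → sign (suc d) * (fromℕ (1 ℕ.* odd!! (suc d) ℕ.* c) * 1/fact (suc d)))
         (k>n⇒nCk≡0 {2 ℕ.* suc d ∸ 1} {2 ℕ.* suc d} ℕ.≤-refl) ⟩
  sign (suc d) * (fromℕ (1 ℕ.* odd!! (suc d) ℕ.* 0) * 1/fact (suc d))
    ≡⟨ cong (λ c → sign (suc d) * (fromℕ c * 1/fact (suc d))) (ℕ.*-zeroʳ (1 ℕ.* odd!! (suc d))) ⟩
  sign (suc d) * (0ℚ * 1/fact (suc d))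
    ≡⟨ solve 2 (λ a b → a :* (con 0ℚ :* b) := con 0ℚ) refl (sign (suc d)) (1/fact (suc d)) ⟩
  0ℚ ∎)
catalan-^ (suc zero) d = trans (*ₛ-identityʳ catalan d)
  (cong (λ o → sign (suc d) * (fromℕ o * 1/fact (suc d))) (sym (begin
    1 ℕ.* odd!! d ℕ.* ((2 ℕ.* d) C (2 ℕ.* d))   ≡⟨ cong (1 ℕ.* odd!! d ℕ.*_) (nCn≡1 (2 ℕ.* d)) ⟩
    1 ℕ.* odd!! d ℕ.* 1                         ≡⟨ ℕ.*-identityʳ (1 ℕ.* odd!! d) ⟩
    1 ℕ.* odd!! d                               ≡⟨ ℕ.*-identityˡ (odd!! d) ⟩
    odd!! d                                     ∎)))
catalan-^ (suc (suc k)) d = begin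
  (catalan ^ₛ suc (suc k)) d
    ≡⟨ catalan-^-rec k d ⟩
  2ℚ * (catalan ^ₛ suc k) (suc d) + 2ℚ * (catalan ^ₛ k) (suc d)
    ≡⟨ cong₂ (λ a b → 2ℚ * a + 2ℚ * b) (catalan-^ (suc k) (suc d)) (catalan-^ k (suc d)) ⟩
  2ℚ * (sign (suc k ℕ.+ suc d) * (p₁ * 1/fact (suc k ℕ.+ suc d))) + 2ℚ * (sign (k ℕ.+ suc d) * (p₀ * 1/fact (k ℕ.+ suc d)))
    ≡⟨ cong (λ n → 2ℚ * (sign (suc n) * (p₁ * 1/fact (suc n))) + 2ℚ * (sign n * (p₀ * 1/fact n))) (ℕ.+-suc k d) ⟩
  2ℚ * (-1ℚ * s * (p₁ * u)) + 2ℚ * (s * (p₀ * 1/fact (suc n)))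
    ≡⟨ cong (λ a → 2ℚ * (-1ℚ * s * (p₁ * u)) + 2ℚ * (s * (p₀ * a))) (suc*1/fact (suc n)) ⟨
  2ℚ * (-1ℚ * s * (p₁ * u)) + 2ℚ * (s * (p₀ * (fromℕ (suc (suc n)) * u)))
    ≡⟨ solve 5 (λ s p₁ p₀ m u →
         con 2ℚ :* (con -1ℚ :* s :* (p₁ :* u)) :+ con 2ℚ :* (s :* (p₀ :* (m :* u))) :=
         con -1ℚ :* s :* ((con 2ℚ :* p₁ :+ :- (con 2ℚ :* (m :* p₀))) :* u)) refl s p₁ p₀ (fromℕ (suc (suc n))) u ⟩
  -1ℚ * s * ((2ℚ * p₁ + - q) * u)
    ≡⟨ cong (λ a → -1ℚ * s * ((a + - q) * u)) 2p₁ ⟩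
  -1ℚ * s * ((p₂ + q + - q) * u)
    ≡⟨ solve 4 (λ s p q u → con -1ℚ :* s :* ((p :+ q :+ :- q) :* u) := con -1ℚ :* s :* (p :* u)) refl s p₂ q u ⟩
  -1ℚ * s * (p₂ * u) ∎
  where
  n : ℕ
  n = k ℕ.+ d
  s u p₀ p₁ p₂ q : ℚ
  s  = sign (suc n)
  u  = 1/fact (suc (suc n))
  p₀ = fromℕ (Pℕ k (suc d))
  p₁ = fromℕ (Pℕ (suc k) (suc d))
  p₂ = fromℕ (Pℕ (suc (suc k)) d)
  q  = 2ℚ * (fromℕ (suc (suc n)) * p₀)

  2p₁ : 2ℚ * p₁ ≡ p₂ + q
  2p₁ = begin
    2ℚ * p₁                                                       ≡⟨ fromℕ-* 2 (Pℕ (suc k) (suc d)) ⟨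
    fromℕ (2 ℕ.* Pℕ (suc k) (suc d))                              ≡⟨ cong fromℕ (Pℕ-rec k d) ⟨
    fromℕ (Pℕ (suc (suc k)) d ℕ.+ 2 ℕ.* (suc (suc n) ℕ.* Pℕ k (suc d)))
      ≡⟨ fromℕ-+ (Pℕ (suc (suc k)) d) (2 ℕ.* (suc (suc n) ℕ.* Pℕ k (suc d))) ⟩
    p₂ + fromℕ (2 ℕ.* (suc (suc n) ℕ.* Pℕ k (suc d)))
      ≡⟨ cong (p₂ +_) (trans (fromℕ-* 2 (suc (suc n) ℕ.* Pℕ k (suc d)))
           (cong (2ℚ *_) (fromℕ-* (suc (suc n)) (Pℕ k (suc d))))) ⟩
    p₂ + q                                                        ∎

-- Bell polynomials as powers of a series

-- Divided powers: with them the binomial theorem is a convolution in k, free of binomial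
-- coefficients.
divPow : ℕ → Series → Series
divPow k f = 1/fact k ·ₛ (f ^ₛ k)

divPow-suc : ∀ k f n → fromℕ (suc k) * divPow (suc k) f n ≡ (f *ₛ divPow k f) n
divPow-suc k f n = begin
  fromℕ (suc k) * (1/fact (suc k) * (f *ₛ (f ^ₛ k)) n)
    ≡⟨ ℚ.*-assoc (fromℕ (suc k)) (1/fact (suc k)) _ ⟨
  fromℕ (suc k) * 1/fact (suc k) * (f *ₛ (f ^ₛ k)) n
    ≡⟨ cong (_* (f *ₛ (f ^ₛ k)) n) (suc*1/fact k) ⟩
  1/fact k * (f *ₛ (f ^ₛ k)) n
    ≡⟨ *ₛ-·ₛ-assoc (1/fact k) f (f ^ₛ k) n ⟨
  (f *ₛ divPow k f) n ∎

expₛ[_] : ℚ → Series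
expₛ[ c ] j = c ^ j * 1/fact j

expₛ-suc : ∀ c j → θ expₛ[ c ] (suc j) ≡ c * expₛ[ c ] j
expₛ-suc c j = trans
  (solve 4 (λ n c p q → n :* (c :* p :* q) := c :* (p :* (n :* q))) refl
    (fromℕ (suc j)) c (c ^ j) (1/fact (suc j)))
  (cong (λ a → c * (c ^ j * a)) (suc*1/fact j))

-- Both sides, as series in k, satisfy the same first-order differential equation.
divPow-const+ : ∀ c f k n →
  divPow k ((c ·ₛ 1ₛ) +ₛ f) n ≡ (expₛ[ c ] *ₛ (λ j → divPow j f n)) k
divPow-const+ c f zero n =
  solve 1 (λ a → a := con 1ℚ :* a :+ con 0ℚ) refl (1/fact 0 * 1ₛ n)
divPow-const+ c f (suc k) n = fromℕ-cancelˡ (suc k) (begin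
  fromℕ (suc k) * divPow (suc k) c+f n
    ≡⟨ divPow-suc k c+f n ⟩
  (c+f *ₛ divPow k c+f) n
    ≡⟨ *ₛ-distribʳ-+ (divPow k c+f) (c ·ₛ 1ₛ) f n ⟩
  ((c ·ₛ 1ₛ) *ₛ divPow k c+f) n + (f *ₛ divPow k c+f) n
    ≡⟨ cong₂ _+_
         (trans (·ₛ-*ₛ-assoc c 1ₛ (divPow k c+f) n) (cong (c *_)
           (trans (*ₛ-identityˡ (divPow k c+f) n) (divPow-const+ c f k n))))
         (*ₛ-cong {f} (λ _ → refl) (divPow-const+ c f k) n) ⟩
  c * (e *ₛ Φ) k + (f *ₛ (λ m → (e *ₛ (λ j → divPow j f m)) k)) n
    ≡⟨ cong (c * (e *ₛ Φ) k +_)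
         (*ₛ-∑ {suc k} f (λ j → e (toℕ j)) (λ j → divPow (k ∸ toℕ j) f) n) ⟩
  c * (e *ₛ Φ) k + (e *ₛ (λ j → (f *ₛ divPow j f) n)) k
    ≡⟨ cong₂ _+_
         (trans (sym (·ₛ-*ₛ-assoc c e Φ k)) (*ₛ-cong {g = Φ} (λ j → sym (expₛ-suc c j)) (λ _ → refl) k))
         (*ₛ-cong {e} (λ _ → refl) (λ j → sym (divPow-suc j f n)) k) ⟩
  -- As series in k, `e` has derivative c e and `Φ` has derivative f Φ, so the product rule now
  -- applies to `e *ₛ Φ`.
  (tailₛ (θ e) *ₛ Φ) k + (e *ₛ tailₛ (θ Φ)) k
    ≡⟨ cong₂ _+_ (sym (*ₛ-suc {θ e} (ℚ.*-zeroˡ (e 0)) Φ k)) (begin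
         (e *ₛ tailₛ (θ Φ)) k     ≡⟨ *ₛ-comm e (tailₛ (θ Φ)) k ⟩
         (tailₛ (θ Φ) *ₛ e) k     ≡⟨ *ₛ-suc {θ Φ} (ℚ.*-zeroˡ (Φ 0)) e k ⟨
         (θ Φ *ₛ e) (suc k)       ≡⟨ *ₛ-comm (θ Φ) e (suc k) ⟩
         (e *ₛ θ Φ) (suc k)       ∎) ⟩
  (θ e *ₛ Φ) (suc k) + (e *ₛ θ Φ) (suc k)
    ≡⟨ θ-*ₛ e Φ (suc k) ⟨
  fromℕ (suc k) * (e *ₛ Φ) (suc k) ∎)
  where
  e c+f Φ : Series
  e   = expₛ[ c ]
  c+f = (c ·ₛ 1ₛ) +ₛ f
  Φ j = divPow j f n

-- Sums over lists and the Kronecker delta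

ΣL : List X → (X → ℚ) → ℚ
ΣL xs h = List.foldr _+_ 0ℚ (List.map h xs)

ΣL-cong : ∀ {h h′ : X → ℚ} xs → h ≗ h′ → ΣL xs h ≡ ΣL xs h′
ΣL-cong []       p = refl
ΣL-cong (a ∷ xs) p = cong₂ _+_ (p a) (ΣL-cong xs p)

ΣL-zero : ∀ {h : X → ℚ} xs → (∀ a → h a ≡ 0ℚ) → ΣL xs h ≡ 0ℚ
ΣL-zero []       p = refl
ΣL-zero (a ∷ xs) p = cong₂ _+_ (p a) (ΣL-zero xs p)

ΣL-distribˡ : ∀ c (h : X → ℚ) xs → ΣL xs (λ a → c * h a) ≡ c * ΣL xs h
ΣL-distribˡ c h []       = sym (ℚ.*-zeroʳ c)
ΣL-distribˡ c h (a ∷ xs) = trans (cong (c * h a +_) (ΣL-distribˡ c h xs))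
  (sym (ℚ.*-distribˡ-+ c (h a) (ΣL xs h)))

ΣL-++ : ∀ (h : X → ℚ) xs ys → ΣL (xs List.++ ys) h ≡ ΣL xs h + ΣL ys h
ΣL-++ h []       ys = sym (ℚ.+-identityˡ (ΣL ys h))
ΣL-++ h (a ∷ xs) ys = trans (cong (h a +_) (ΣL-++ h xs ys)) (sym (ℚ.+-assoc (h a) (ΣL xs h) (ΣL ys h)))

ΣL-cartesianProductWith : ∀ (f : X → Y → Z) (h : Z → ℚ) xs ys →
  ΣL (List.cartesianProductWith f xs ys) h ≡ ΣL xs (λ a → ΣL ys (λ b → h (f a b)))
ΣL-cartesianProductWith f h []       ys = refl
ΣL-cartesianProductWith f h (a ∷ xs) ys = trans
  (ΣL-++ h (List.map (f a) ys) (List.cartesianProductWith f xs ys))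
  (cong₂ _+_ (cong (List.foldr _+_ 0ℚ) (sym (List.map-∘ ys))) (ΣL-cartesianProductWith f h xs ys))

ΣL-applyUpTo : ∀ (f : ℕ → X) (h : X → ℚ) n → ΣL (List.applyUpTo f n) h ≡ sum {n} (λ i → h (f (toℕ i)))
ΣL-applyUpTo f h zero    = refl
ΣL-applyUpTo f h (suc n) = cong (h (f 0) +_) (ΣL-applyUpTo (f ∘ suc) h n)

-- A filter on tuples does not split along the cartesian product that enumerates them; a summand
-- that is zero outside the predicate does.
ΣL-filter : ∀ {P : Pred X 0ℓ} (P? : Decidable P) {h c : X → ℚ} →
  (∀ a → P a → h a ≡ c a) → (∀ a → ¬ P a → 0ℚ ≡ c a) → ∀ xs → ΣL (List.filter P? xs) h ≡ ΣL xs c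
ΣL-filter P? p q []       = refl
ΣL-filter P? {h} {c} p q (a ∷ xs) with P? a
... | yes pa = cong₂ _+_ (p a pa) (ΣL-filter P? p q xs)
... | no ¬pa = trans (ΣL-filter P? p q xs)
  (trans (sym (ℚ.+-identityˡ (ΣL xs c))) (cong (_+ ΣL xs c) (q a ¬pa)))

-- Recursion on both arguments lets a common summand cancel, as in `δ-+`.
δ : ℕ → ℕ → ℚ
δ zero    zero    = 1ℚ
δ zero    (suc _) = 0ℚ
δ (suc _) zero    = 0ℚ
δ (suc a) (suc b) = δ a b

δ-≡ : ∀ {a b} → a ≡ b → δ a b ≡ 1ℚ
δ-≡ {zero}  refl = refl
δ-≡ {suc a} refl = δ-≡ {a} refl

δ-≢ : ∀ a b → a ≢ b → δ a b ≡ 0ℚ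
δ-≢ zero    zero    a≢b with () ← a≢b refl
δ-≢ zero    (suc b) a≢b = refl
δ-≢ (suc a) zero    a≢b = refl
δ-≢ (suc a) (suc b) a≢b = δ-≢ a b (a≢b ∘ cong suc)

δ-+ : ∀ c a b → δ (c ℕ.+ a) (c ℕ.+ b) ≡ δ a b
δ-+ zero    a b = refl
δ-+ (suc c) a b = δ-+ c a b

δ-subst : ∀ a b (F : ℕ → ℚ) → δ a b * F a ≡ δ a b * F b
δ-subst a b F with a ℕ.≟ b
... | yes refl = refl
... | no a≢b   = trans (cong (_* F a) (δ-≢ a b a≢b)) (trans (ℚ.*-zeroˡ (F a))
  (sym (trans (cong (_* F b) (δ-≢ a b a≢b)) (ℚ.*-zeroˡ (F b)))))

-- Sums over exponent tuples, one variable at a time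

sum-tabulate-+ : ∀ {N} (f g : Fin N → ℕ) →
  Vec.sum (Vec.tabulate (λ i → f i ℕ.+ g i)) ≡ Vec.sum (Vec.tabulate f) ℕ.+ Vec.sum (Vec.tabulate g)
sum-tabulate-+ {zero}  f g = refl
sum-tabulate-+ {suc N} f g = trans
  (cong (f fzero ℕ.+ g fzero ℕ.+_) (sum-tabulate-+ (f ∘ fsuc) (g ∘ fsuc)))
  (interchange (f fzero) (g fzero) _ _)

-- A new first entry moves all others one position on, raising each multiplier by one; hence the
-- extra `Vec.sum ℓ`.
weight-∷ : ∀ {N} j (ℓ : Vec ℕ N) → weight (j ∷ ℓ) ≡ j ℕ.+ (Vec.sum ℓ ℕ.+ weight ℓ)
weight-∷ j ℓ = cong₂ ℕ._+_ (ℕ.+-identityʳ j) (trans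
  (sum-tabulate-+ (Vec.lookup ℓ) (λ i → suc (toℕ i) ℕ.* Vec.lookup ℓ i))
  (cong (λ v → Vec.sum v ℕ.+ weight ℓ) (Vec.tabulate∘lookup ℓ)))

monomial : ∀ {N} → Vector ℚ N → Vec ℕ N → ℚ
monomial y ℓ = product (λ i → 1/fact (Vec.lookup ℓ i)) * product (λ i → y i ^ Vec.lookup ℓ i)

monomial-∷ : ∀ {N} (y : Vector ℚ (suc N)) j ℓ →
  monomial y (j ∷ ℓ) ≡ expₛ[ y fzero ] j * monomial (y ∘ fsuc) ℓ
monomial-∷ y j ℓ = solve 4 (λ a b c d → a :* b :* (c :* d) := (c :* a) :* (b :* d)) refl
  (1/fact j) (product (λ i → 1/fact (Vec.lookup ℓ i)))
  (y fzero ^ j) (product (λ i → y (fsuc i) ^ Vec.lookup ℓ i))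

▹ₛ_ : Series → Series
(▹ₛ f) zero    = 0ℚ
(▹ₛ f) (suc n) = f n

infix 10 ▹ₛ_

poly : ∀ {N} → Vector ℚ N → Series
poly {zero}  y n       = 0ℚ
poly {suc N} y zero    = y fzero
poly {suc N} y (suc n) = poly (y ∘ fsuc) n

poly-toℕ : ∀ {N} (f : Series) {i} → i < N → poly {N} (f ∘ toℕ) i ≡ f i
poly-toℕ f {zero}  (s≤s _)   = refl
poly-toℕ f {suc i} (s≤s i<N) = poly-toℕ (tailₛ f) i<N

poly-∷ : ∀ {N} (y : Vector ℚ (suc N)) → poly y ≗ (y fzero ·ₛ 1ₛ) +ₛ ▹ₛ poly (y ∘ fsuc)
poly-∷ y zero    = solve 1 (λ a → a := a :* con 1ℚ :+ con 0ℚ) refl (y fzero)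
poly-∷ y (suc n) = solve 2 (λ a b → b := a :* con 0ℚ :+ b) refl (y fzero) (poly (y ∘ fsuc) n)

-- Removing ℓ₁ lowers k while the remaining tuples keep their bound, so the bound b is a parameter
-- of its own.
tupleSum : ∀ {N} → ℕ → Vector ℚ N → ℕ → ℕ → ℚ
tupleSum {N} b y k n = ΣL (tuples b N) (λ ℓ → δ (Vec.sum ℓ) k * δ (weight ℓ) n * monomial y ℓ)

-- If ℓ₁ = j, the other entries sum to k - j, and the weight of the whole is j + (k - j) +
-- `weight ℓ` = k + `weight ℓ`. The condition on the weight thus loses its dependence on j, and what
-- is left is a convolution.
tupleSum-∷ : ∀ {N} (y : Vector ℚ (suc N)) b k n → k ≤ b →
  tupleSum b y k n ≡ sum {suc k} (λ j → expₛ[ y fzero ] (toℕ j) *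
    ΣL (tuples b N) (λ ℓ → δ (Vec.sum ℓ) (k ∸ toℕ j) * δ (k ℕ.+ weight ℓ) n * monomial (y ∘ fsuc) ℓ))
tupleSum-∷ {N} y b k n k≤b = begin
  tupleSum b y k n
    ≡⟨ ΣL-cartesianProductWith _∷_ _ (List.upTo (suc b)) (tuples b N) ⟩
  ΣL (List.upTo (suc b)) (λ j → ΣL (tuples b N) (λ ℓ → F j ℓ))
    ≡⟨ ΣL-applyUpTo (λ j → j) (λ j → ΣL (tuples b N) (λ ℓ → F j ℓ)) (suc b) ⟩
  sum {suc b} (λ j → ΣL (tuples b N) (λ ℓ → F (toℕ j) ℓ))
    ≡⟨ sum-truncate (λ j → ΣL (tuples b N) (λ ℓ → F j ℓ)) (s≤s k≤b)
         (λ {j} k<j → ΣL-zero (tuples b N) (λ ℓ → F-vanish j ℓ k<j)) ⟩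
  sum {suc k} (λ j → ΣL (tuples b N) (λ ℓ → F (toℕ j) ℓ))
    ≡⟨ sum-cong-≗ {suc k} (λ j → trans
         (ΣL-cong (tuples b N) (F-shift (toℕ j) (s≤s⁻¹ (Fin.toℕ<n j))))
         (ΣL-distribˡ (expₛ[ y fzero ] (toℕ j)) (G (toℕ j)) (tuples b N))) ⟩
  sum {suc k} (λ j → expₛ[ y fzero ] (toℕ j) * ΣL (tuples b N) (G (toℕ j))) ∎
  where
  F G : ℕ → Vec ℕ N → ℚ
  F j ℓ = δ (j ℕ.+ Vec.sum ℓ) k * δ (weight (j ∷ ℓ)) n * monomial y (j ∷ ℓ)
  G j ℓ = δ (Vec.sum ℓ) (k ∸ j) * δ (k ℕ.+ weight ℓ) n * monomial (y ∘ fsuc) ℓ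

  F-vanish : ∀ j ℓ → k < j → F j ℓ ≡ 0ℚ
  F-vanish j ℓ k<j = trans
    (cong (λ a → a * δ (weight (j ∷ ℓ)) n * monomial y (j ∷ ℓ))
      (δ-≢ (j ℕ.+ Vec.sum ℓ) k (λ eq → ℕ.<-irrefl (sym eq) (ℕ.≤-trans k<j (ℕ.m≤m+n j (Vec.sum ℓ))))))
    (solve 2 (λ a b → con 0ℚ :* a :* b := con 0ℚ) refl (δ (weight (j ∷ ℓ)) n) (monomial y (j ∷ ℓ)))

  F-shift : ∀ j → j ≤ k → ∀ ℓ → F j ℓ ≡ expₛ[ y fzero ] j * G j ℓ
  F-shift j j≤k ℓ = begin
    δ (j ℕ.+ s) k * δ (weight (j ∷ ℓ)) n * monomial y (j ∷ ℓ)
      ≡⟨ cong₂ (λ a w → δ (j ℕ.+ s) a * δ w n * monomial y (j ∷ ℓ)) (sym k≡) (weight-∷ j ℓ) ⟩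
    δ (j ℕ.+ s) (j ℕ.+ (k ∸ j)) * δ (j ℕ.+ (s ℕ.+ weight ℓ)) n * monomial y (j ∷ ℓ)
      ≡⟨ cong (λ a → a * δ (j ℕ.+ (s ℕ.+ weight ℓ)) n * monomial y (j ∷ ℓ)) (δ-+ j s (k ∸ j)) ⟩
    δ s (k ∸ j) * δ (j ℕ.+ (s ℕ.+ weight ℓ)) n * monomial y (j ∷ ℓ)
      ≡⟨ cong (_* monomial y (j ∷ ℓ)) (δ-subst s (k ∸ j) (λ s → δ (j ℕ.+ (s ℕ.+ weight ℓ)) n)) ⟩
    δ s (k ∸ j) * δ (j ℕ.+ ((k ∸ j) ℕ.+ weight ℓ)) n * monomial y (j ∷ ℓ)
      ≡⟨ cong₂ (λ w a → δ s (k ∸ j) * δ w n * a)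
           (trans (sym (ℕ.+-assoc j (k ∸ j) (weight ℓ))) (cong (ℕ._+ weight ℓ) k≡)) (monomial-∷ y j ℓ) ⟩
    δ s (k ∸ j) * δ (k ℕ.+ weight ℓ) n * (expₛ[ y fzero ] j * monomial (y ∘ fsuc) ℓ)
      ≡⟨ solve 4 (λ a b c d → a :* b :* (c :* d) := c :* (a :* b :* d)) refl
           (δ s (k ∸ j)) (δ (k ℕ.+ weight ℓ) n) (expₛ[ y fzero ] j) (monomial (y ∘ fsuc) ℓ) ⟩
    expₛ[ y fzero ] j * G j ℓ ∎
    where
    s : ℕ
    s = Vec.sum ℓ
    k≡ : j ℕ.+ (k ∸ j) ≡ k
    k≡ = ℕ.m+[n∸m]≡n j≤k

-- Induction on the number of variables. Below degree k both sides vanish. From degree k on,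
-- cancelling k in the weight condition matches taking tᵏ out of the power, and `divPow-const+`
-- splits off the first variable.
tupleSum-divPow : ∀ {N} (y : Vector ℚ N) {b} k n → k ≤ b → tupleSum b y k n ≡ divPow k (▹ₛ poly y) n
tupleSum-divPow {zero} y zero    zero    _ = refl
tupleSum-divPow {zero} y zero    (suc n) _ = refl
tupleSum-divPow {zero} y (suc k) n       _ = begin
  0ℚ * δ 0 n * 1ℚ + 0ℚ
    ≡⟨ solve 2 (λ a b → con 0ℚ :* a :* con 1ℚ :+ con 0ℚ := b :* con 0ℚ) refl (δ 0 n) (1/fact (suc k)) ⟩
  1/fact (suc k) * 0ℚ
    ≡⟨ cong (1/fact (suc k) *_) (trans (*ₛ-cong {g = (▹ₛ poly y) ^ₛ k} ▹-zero (λ _ → refl) n) (*ₛ-zeroˡ ((▹ₛ poly y) ^ₛ k) n)) ⟨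
  divPow (suc k) (▹ₛ poly y) n ∎
  where
  ▹-zero : ▹ₛ poly y ≗ 0ₛ
  ▹-zero zero    = refl
  ▹-zero (suc _) = refl
tupleSum-divPow {suc N} y {b} k n k≤b with n ℕ.<? k
... | yes n<k = begin
  tupleSum b y k n
    ≡⟨ tupleSum-∷ y b k n k≤b ⟩
  sum {suc k} (λ j → e (toℕ j) * ΣL (tuples b N) (λ ℓ → δ (Vec.sum ℓ) (k ∸ toℕ j) * δ (k ℕ.+ weight ℓ) n * monomial y′ ℓ))
    ≡⟨ sum-zero {suc k} (λ j → trans (cong (e (toℕ j) *_) (ΣL-zero (tuples b N) (λ ℓ → vanish (toℕ j) ℓ)))
         (ℚ.*-zeroʳ (e (toℕ j)))) ⟩
  0ℚ
    ≡⟨ trans (cong (1/fact k *_) (^ₛ-vanish {▹ₛ poly y} refl k n<k)) (ℚ.*-zeroʳ (1/fact k)) ⟨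
  divPow k (▹ₛ poly y) n ∎
  where
  e : Series
  e = expₛ[ y fzero ]
  y′ : Vector ℚ N
  y′ = y ∘ fsuc
  vanish : ∀ j ℓ → δ (Vec.sum ℓ) (k ∸ j) * δ (k ℕ.+ weight ℓ) n * monomial y′ ℓ ≡ 0ℚ
  vanish j ℓ = trans
    (cong (λ a → δ (Vec.sum ℓ) (k ∸ j) * a * monomial y′ ℓ)
      (δ-≢ (k ℕ.+ weight ℓ) n (λ eq → ℕ.<-irrefl (sym eq) (ℕ.<-≤-trans n<k (ℕ.m≤m+n k (weight ℓ))))))
    (solve 2 (λ a b → a :* con 0ℚ :* b := con 0ℚ) refl (δ (Vec.sum ℓ) (k ∸ j)) (monomial y′ ℓ))
... | no n≮k = subst (λ n → tupleSum b y k n ≡ divPow k (▹ₛ poly y) n) (ℕ.m+[n∸m]≡n (ℕ.≮⇒≥ n≮k)) (begin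
  tupleSum b y k (k ℕ.+ m)
    ≡⟨ tupleSum-∷ y b k (k ℕ.+ m) k≤b ⟩
  sum {suc k} (λ j → e (toℕ j) * ΣL (tuples b N) (λ ℓ → δ (Vec.sum ℓ) (k ∸ toℕ j) * δ (k ℕ.+ weight ℓ) (k ℕ.+ m) * monomial y′ ℓ))
    ≡⟨ sum-cong-≗ {suc k} (λ j → cong (e (toℕ j) *_) (trans
         (ΣL-cong (tuples b N) (λ ℓ → cong (λ a → δ (Vec.sum ℓ) (k ∸ toℕ j) * a * monomial y′ ℓ) (δ-+ k (weight ℓ) m)))
         (tupleSum-divPow y′ (k ∸ toℕ j) m (ℕ.≤-trans (ℕ.m∸n≤m k (toℕ j)) k≤b)))) ⟩
  (e *ₛ (λ j → divPow j (▹ₛ poly y′) m)) k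
    ≡⟨ divPow-const+ (y fzero) (▹ₛ poly y′) k m ⟨
  divPow k ((y fzero ·ₛ 1ₛ) +ₛ ▹ₛ poly y′) m
    ≡⟨ cong (1/fact k *_) (^ₛ-cong-≤ m (λ {i} _ → poly-∷ y i) k) ⟨
  divPow k (poly y) m
    ≡⟨ cong (1/fact k *_) (^ₛ-drop {▹ₛ poly y} refl k m) ⟨
  divPow k (▹ₛ poly y) (k ℕ.+ m) ∎)
  where
  m : ℕ
  m = n ∸ k
  e : Series
  e = expₛ[ y fzero ]
  y′ : Vector ℚ N
  y′ = y ∘ fsuc

-- After tᵏ is taken out, degree n - k of hᵏ involves only the first n - k + 1 coefficients of h.
-- These are exactly the arguments of B, so the polynomial may be exchanged for the full series.
B-divPow : ∀ n k (a : ℕ → ℚ) → k ≤ n →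
  B n k (λ i → a (toℕ i)) ≡ fromℕ (n !) * divPow k (λ i → a i * 1/fact (suc i)) (n ∸ k)
B-divPow n k a k≤n = begin
  B n k (λ i → a (toℕ i))
    ≡⟨ ΣL-filter _ on off (tuples k N) ⟩
  ΣL (tuples k N) (λ ℓ → fromℕ (n !) * (δ (Vec.sum ℓ) k * δ (weight ℓ) n * monomial y ℓ))
    ≡⟨ ΣL-distribˡ (fromℕ (n !)) _ (tuples k N) ⟩
  fromℕ (n !) * tupleSum k y k n
    ≡⟨ cong (fromℕ (n !) *_) (begin
         tupleSum k y k n                            ≡⟨ tupleSum-divPow y k n ℕ.≤-refl ⟩
         divPow k (▹ₛ poly y) n                      ≡⟨ cong (divPow k (▹ₛ poly y)) (ℕ.m+[n∸m]≡n k≤n) ⟨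
         divPow k (▹ₛ poly y) (k ℕ.+ (n ∸ k))        ≡⟨ cong (1/fact k *_) (^ₛ-drop {▹ₛ poly y} refl k (n ∸ k)) ⟩
         divPow k (poly y) (n ∸ k)                   ≡⟨ cong (1/fact k *_) (^ₛ-cong-≤ (n ∸ k) (λ i≤ → poly-toℕ h (s≤s i≤)) k) ⟩
         divPow k h (n ∸ k)                          ∎) ⟩
  fromℕ (n !) * divPow k h (n ∸ k) ∎
  where
  N : ℕ
  N = suc (n ∸ k)
  h : Series
  h i = a i * 1/fact (suc i)
  y : Vector ℚ N
  y = h ∘ toℕ

  on : ∀ ℓ → weight ℓ ≡ n × Vec.sum ℓ ≡ k →
       fromℕ (n !) * product (λ i → 1/fact (Vec.lookup ℓ i)) * product (λ i → y i ^ Vec.lookup ℓ i) ≡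
       fromℕ (n !) * (δ (Vec.sum ℓ) k * δ (weight ℓ) n * monomial y ℓ)
  on ℓ (w≡n , s≡k) = begin
    fromℕ (n !) * p * q                             ≡⟨ solve 3 (λ a p q → a :* p :* q := a :* (con 1ℚ :* con 1ℚ :* (p :* q))) refl (fromℕ (n !)) p q ⟩
    fromℕ (n !) * (1ℚ * 1ℚ * (p * q))               ≡⟨ cong₂ (λ u v → fromℕ (n !) * (u * v * (p * q))) (δ-≡ s≡k) (δ-≡ w≡n) ⟨
    fromℕ (n !) * (δ (Vec.sum ℓ) k * δ (weight ℓ) n * monomial y ℓ)    ∎
    where
    p q : ℚ
    p = product (λ i → 1/fact (Vec.lookup ℓ i))
    q = product (λ i → y i ^ Vec.lookup ℓ i)

  off : ∀ ℓ → ¬ (weight ℓ ≡ n × Vec.sum ℓ ≡ k) →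
        0ℚ ≡ fromℕ (n !) * (δ (Vec.sum ℓ) k * δ (weight ℓ) n * monomial y ℓ)
  off ℓ ¬eq with Vec.sum ℓ ℕ.≟ k | weight ℓ ℕ.≟ n
  ... | yes s≡k | yes w≡n with () ← ¬eq (w≡n , s≡k)
  ... | no  s≢k | _       = sym (trans
    (cong (λ u → fromℕ (n !) * (u * δ (weight ℓ) n * monomial y ℓ)) (δ-≢ (Vec.sum ℓ) k s≢k))
    (solve 3 (λ a b c → a :* (con 0ℚ :* b :* c) := con 0ℚ) refl (fromℕ (n !)) (δ (weight ℓ) n) (monomial y ℓ)))
  ... | yes _   | no  w≢n = sym (trans
    (cong (λ u → fromℕ (n !) * (δ (Vec.sum ℓ) k * u * monomial y ℓ)) (δ-≢ (weight ℓ) n w≢n))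
    (solve 3 (λ a b c → a :* (b :* con 0ℚ :* c) := con 0ℚ) refl (fromℕ (n !)) (δ (Vec.sum ℓ) k) (monomial y ℓ)))

-- The exponential generating function of x

-- The substitution t ↦ -t. Splitting it off leaves a series in eᵗ - 1, whose powers define S.
reflect : Series → Series
reflect f n = sign n * f n

reflect-*ₛ : ∀ f g → reflect f *ₛ reflect g ≗ reflect (f *ₛ g)
reflect-*ₛ f g zero =
  solve 2 (λ a b → con 1ℚ :* a :* (con 1ℚ :* b) :+ con 0ℚ := con 1ℚ :* (a :* b :+ con 0ℚ)) refl (f 0) (g 0)
reflect-*ₛ f g (suc n) = begin
  1ℚ * f 0 * (-1ℚ * sign n * g (suc n)) + (tailₛ (reflect f) *ₛ reflect g) n
    ≡⟨ cong (1ℚ * f 0 * (-1ℚ * sign n * g (suc n)) +_) (begin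
         (tailₛ (reflect f) *ₛ reflect g) n
           ≡⟨ *ₛ-cong {g = reflect g} (λ i → ℚ.*-assoc -1ℚ (sign i) (f (suc i))) (λ _ → refl) n ⟩
         ((-1ℚ ·ₛ reflect (tailₛ f)) *ₛ reflect g) n
           ≡⟨ ·ₛ-*ₛ-assoc -1ℚ (reflect (tailₛ f)) (reflect g) n ⟩
         -1ℚ * (reflect (tailₛ f) *ₛ reflect g) n
           ≡⟨ cong (-1ℚ *_) (reflect-*ₛ (tailₛ f) g n) ⟩
         -1ℚ * (sign n * (tailₛ f *ₛ g) n) ∎) ⟩
  1ℚ * f 0 * (-1ℚ * sign n * g (suc n)) + -1ℚ * (sign n * (tailₛ f *ₛ g) n)
    ≡⟨ solve 4 (λ s a b c → con 1ℚ :* a :* (con -1ℚ :* s :* b) :+ con -1ℚ :* (s :* c) :=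
         con -1ℚ :* s :* (a :* b :+ c)) refl (sign n) (f 0) (g (suc n)) ((tailₛ f *ₛ g) n) ⟩
  sign (suc n) * (f *ₛ g) (suc n) ∎

reflect-^ₛ : ∀ f k → reflect f ^ₛ k ≗ reflect (f ^ₛ k)
reflect-^ₛ f zero    zero    = refl
reflect-^ₛ f zero    (suc n) = sym (ℚ.*-zeroʳ (sign (suc n)))
reflect-^ₛ f (suc k) n       = trans (*ₛ-cong {reflect f} (λ _ → refl) (reflect-^ₛ f k) n) (reflect-*ₛ f (f ^ₛ k) n)

expm1 : Series
expm1 = expₛ -ₛ 1ₛ

-- 1 - √(2eᵗ - 1)
root : Series
root = ▹ₛ catalan ∘ₛ expm1

-- Restricted to positive degrees: `x 0` is -1, whereas `root` has constant term 0.
x-egf : ∀ i → x (suc i) * 1/fact (suc i) ≡ reflect root (suc i)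
x-egf i = begin
  sign i * sum {suc n} (summand ∘ toℕ) * 1/fact n
    ≡⟨ cong (λ a → sign i * a * 1/fact n) (begin
         sum {suc n} (summand ∘ toℕ)                          ≡⟨ sum-cong-≗ {suc n} (step ∘ toℕ) ⟩
         sum {suc n} (λ ℓ → -1ℚ * fromℕ (n !) * coeff (toℕ ℓ)) ≡⟨ *-distribˡ-sum {suc n} (-1ℚ * fromℕ (n !)) (coeff ∘ toℕ) ⟨
         -1ℚ * fromℕ (n !) * root n                           ∎) ⟩
  sign i * (-1ℚ * fromℕ (n !) * root n) * 1/fact n
    ≡⟨ solve 5 (λ s m a r b → s :* (m :* a :* r) :* b := m :* s :* r :* (a :* b)) refl
         (sign i) -1ℚ (fromℕ (n !)) (root n) (1/fact n) ⟩
  -1ℚ * sign i * root n * (fromℕ (n !) * 1/fact n)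
    ≡⟨ cong (-1ℚ * sign i * root n *_) (n!*1/fact n) ⟩
  -1ℚ * sign i * root n * 1ℚ
    ≡⟨ ℚ.*-identityʳ (-1ℚ * sign i * root n) ⟩
  -1ℚ * sign i * root n ∎
  where
  n : ℕ
  n = suc i

  summand coeff : ℕ → ℚ
  summand ℓ = [-1]^ (ℤ.+ ℓ ℤ.- ℤ.1ℤ) * S n ℓ * [2 ℤ.+ ℓ ℤ.- ℤ.1ℤ -1]!!
  coeff   ℓ = (▹ₛ catalan) ℓ * (expm1 ^ₛ ℓ) n

  step : ∀ ℓ → summand ℓ ≡ -1ℚ * fromℕ (n !) * coeff ℓ
  -- At ℓ = 0 the value [-3]!! = -1 meets S(n, 0) = 0, as n is positive.
  step zero    = solve 1 (λ a → con -1ℚ :* (a :* (con 1ℚ :* con 0ℚ)) :* con -1ℚ := con -1ℚ :* a :* (con 0ℚ :* con 0ℚ))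
    refl (fromℕ (n !))
  -- With ℓ = d + 1, (2ℓ - 3)!! is `odd!! d`, and the additional sign in `catalan` is the -1 in
  -- front.
  step (suc d) = solve 6 (λ s m n f w o → s :* (n :* (f :* w)) :* o := con -1ℚ :* n :* (con -1ℚ :* s :* (o :* f) :* w)) refl
    (sign d) -1ℚ (fromℕ (n !)) (1/fact (suc d)) ((expm1 ^ₛ suc d) n) (fromℕ (odd!! d))

-- The k-th power of w γ(w) starts at wᵏ; this is the origin of the lower limit ℓ = k in the
-- theorem.
root-^ : ∀ k m → (root ^ₛ k) (k ℕ.+ m) ≡
  sum {suc m} (λ i → (catalan ^ₛ k) (toℕ i) * (expm1 ^ₛ (k ℕ.+ toℕ i)) (k ℕ.+ m))
root-^ k m = begin
  (root ^ₛ k) n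
    ≡⟨ ∘ₛ-^ₛ {expm1} refl (▹ₛ catalan) k n ⟨
  ((▹ₛ catalan) ^ₛ k ∘ₛ expm1) n
    ≡⟨ cong (λ N → sum {N} (F ∘ toℕ)) (ℕ.+-suc k m) ⟨
  sum {k ℕ.+ suc m} (F ∘ toℕ)
    ≡⟨ sum-drop k F (λ {ℓ} ℓ<k → trans (cong (_* (expm1 ^ₛ ℓ) n) (^ₛ-vanish {▹ₛ catalan} refl k ℓ<k))
         (ℚ.*-zeroˡ ((expm1 ^ₛ ℓ) n))) ⟩
  sum {suc m} (λ i → F (k ℕ.+ toℕ i))
    ≡⟨ sum-cong-≗ {suc m} (λ i → cong (_* (expm1 ^ₛ (k ℕ.+ toℕ i)) n) (^ₛ-drop {▹ₛ catalan} refl k (toℕ i))) ⟩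
  sum {suc m} (λ i → (catalan ^ₛ k) (toℕ i) * (expm1 ^ₛ (k ℕ.+ toℕ i)) n) ∎
  where
  n : ℕ
  n = k ℕ.+ m
  F : ℕ → ℚ
  F ℓ = ((▹ₛ catalan) ^ₛ k) ℓ * (expm1 ^ₛ ℓ) n

stirlingSum : ℕ → ℕ → ℚ
stirlingSum n k = [-1]^ (ℤ.+ n) * 1/fact k * (∑[ ℓ ∈ k ⋯ n ] [-1]^ (ℤ.+ ℓ) * S n ℓ * P ℓ k)

divPow≡stirlingSum : ∀ k m →
  fromℕ ((k ℕ.+ m) !) * divPow k (λ i → x (suc i) * 1/fact (suc i)) m ≡ stirlingSum (k ℕ.+ m) k
divPow≡stirlingSum k m = begin
  n!ℚ * (1/fact k * ((λ i → x (suc i) * 1/fact (suc i)) ^ₛ k) m)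
    ≡⟨ cong (λ a → n!ℚ * (1/fact k * a)) (begin
         ((λ i → x (suc i) * 1/fact (suc i)) ^ₛ k) m   ≡⟨ ^ₛ-cong-≤ m (λ {i} _ → x-egf i) k ⟩
         (tailₛ (reflect root) ^ₛ k) m                 ≡⟨ ^ₛ-drop {reflect root} refl k m ⟨
         (reflect root ^ₛ k) n                         ≡⟨ reflect-^ₛ root k n ⟩
         sign n * (root ^ₛ k) n                        ≡⟨ cong (sign n *_) (root-^ k m) ⟩
         sign n * sum {suc m} coeff                    ∎) ⟩
  n!ℚ * (1/fact k * (sign n * sum {suc m} coeff))
    ≡⟨ solve 4 (λ a b c d → a :* (b :* (c :* d)) := c :* b :* (a :* d)) refl n!ℚ (1/fact k) (sign n) (sum {suc m} coeff) ⟩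
  sign n * 1/fact k * (n!ℚ * sum {suc m} coeff)
    ≡⟨ cong (sign n * 1/fact k *_) (begin
         n!ℚ * sum {suc m} coeff              ≡⟨ *-distribˡ-sum {suc m} n!ℚ coeff ⟩
         sum {suc m} (λ i → n!ℚ * coeff i)    ≡⟨ sum-cong-≗ {suc m} (step ∘ toℕ) ⟩
         sum {suc m} (term ∘ toℕ)             ≡⟨ cong (λ N → sum {N} (term ∘ toℕ)) suc-n∸k ⟨
         sum {suc n ∸ k} (term ∘ toℕ)         ∎) ⟩
  stirlingSum n k ∎
  where
  n : ℕ
  n = k ℕ.+ m
  n!ℚ : ℚ
  n!ℚ = fromℕ (n !)
  coeff : Fin (suc m) → ℚ
  coeff i = (catalan ^ₛ k) (toℕ i) * (expm1 ^ₛ (k ℕ.+ toℕ i)) n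
  term : ℕ → ℚ
  term i = sign (k ℕ.+ i) * S n (k ℕ.+ i) * P (k ℕ.+ i) k

  suc-n∸k : suc n ∸ k ≡ suc m
  suc-n∸k = trans (cong (_∸ k) (sym (ℕ.+-suc k m))) (ℕ.m+n∸m≡n k (suc m))

  step : ∀ i → n!ℚ * ((catalan ^ₛ k) i * (expm1 ^ₛ (k ℕ.+ i)) n) ≡ term i
  step i = begin
    n!ℚ * ((catalan ^ₛ k) i * w)
      ≡⟨ cong (λ a → n!ℚ * (a * w)) (catalan-^ k i) ⟩
    n!ℚ * (sign (k ℕ.+ i) * (fromℕ (Pℕ k i) * 1/fact (k ℕ.+ i)) * w)
      ≡⟨ solve 5 (λ a s p f w → a :* (s :* (p :* f) :* w) := s :* (a :* (f :* w)) :* p) refl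
           n!ℚ (sign (k ℕ.+ i)) (fromℕ (Pℕ k i)) (1/fact (k ℕ.+ i)) w ⟩
    sign (k ℕ.+ i) * S n (k ℕ.+ i) * fromℕ (Pℕ k i)
      ≡⟨ cong (sign (k ℕ.+ i) * S n (k ℕ.+ i) *_) (P≡Pℕ k i) ⟨
    term i ∎
    where
    w : ℚ
    w = (expm1 ^ₛ (k ℕ.+ i)) n

open import Data.Integer.Base using (+_)

theorem3p4 : (map x (1 ∷ 2 ∷ 3 ∷ 4 ∷ 5 ∷ 6 ∷ []) ≡ map fromℕ (1 ∷ 0 ∷ 1 ∷ 3 ∷ 16 ∷ 105 ∷ []))
    × (∀ (n k : ℕ) → k ≤ n →
    B n k (λ i → x (suc (toℕ i)))
    ≡ [-1]^ (+ n) * 1/fact k * (∑[ ℓ ∈ k ⋯ n ] [-1]^ (+ ℓ) * S n ℓ * P ℓ k))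
-- The six listed values hold by evaluation; the general formula is carried from k + (n - k) to n.
theorem3p4 = refl , λ n k k≤n → trans
  (B-divPow n k (x ∘ suc) k≤n)
  (subst (λ n′ → fromℕ (n′ !) * divPow k (λ i → x (suc i) * 1/fact (suc i)) (n ∸ k) ≡ stirlingSum n′ k)
    (ℕ.m+[n∸m]≡n k≤n) (divPow≡stirlingSum k (n ∸ k)))
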